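{- Let $c,d$ be relatively prime integers with $0\le c\le d$, let $\mathbb{P}$ be the one-move rider with move set $\mathbf{M}=\{(c,d)\}$, let $\mathcal{B}\subset\mathbb{Z}^2$ be a convex board with multiset of line sizes $\mathbf{L}^{d/c}(\mathcal{B})$, and let $q\ge 1$ be an integer. Then the number $u_{\mathbb{P}}(q;\mathcal{B})$ of nonattacking configurations of $q$ unlabelled pieces $\mathbb{P}$ on $\mathcal{B}$ is $$u_{\mathbb{P}}(q;\mathcal{B})=\sum_{n_1\lambda_1+\dots+n_k\lambda_k=q}(-1)^{q-\sum_{i=1}^k n_i}\prod_{i=1}^k\frac{1}{\lambda_i^{n_i}\,n_i!}\left(\sum_{l\in\mathbf{L}^{d/c}(\mathcal{B})}l^{\lambda_i}\right)^{n_i},$$ where the outer sum runs over all integer partitions of $q$; for each partition, $\lambda_1,\dots,\lambda_k$ are the distinct positive integers appearing as parts and $n_1,\dots,n_k\ge 1$ are their respective multiplicities.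
   Context: A convex board $\mathcal{B}$ is a finite set of lattice points of the form $K\cap\mathbb{Z}^2$ with $K\subset\mathbb{R}^2$ bounded and convex. A one-move rider with move set $\mathbf{M}=\{(c,d)\}$ (where $c,d$ are relatively prime) is a piece that, from a lattice point $z$, attacks every lattice point $z+k(c,d)$ with $k\in\mathbb{Z}$, $k\neq 0$. A nonattacking configuration of $q$ pieces is a placement of $q$ identical (unlabelled) pieces on $q$ distinct points of $\mathcal{B}$ such that no piece attacks another; $u_{\mathbb{P}}(q;\mathcal{B})$ is the number of such configurations. For $b\in\mathbb{Z}$ let $l_{\mathcal{B}}^{d/c}(b)=\{(x,y)\in\mathcal{B}: dx-cy=b\}$, the set of board points on a line with direction vector $(c,d)$ (slope $d/c$, vertical if $c=0$). The multiset of line sizes is $\mathbf{L}^{d/c}(\mathcal{B})=\{|l_{\mathcal{B}}^{d/c}(b)| : b\in\mathbb{Z},\ l_{\mathcal{B}}^{d/c}(b)\neq\emptyset\}$, with one entry for each $b$ such that the line is nonempty. Sums over $\mathbf{L}^{d/c}(\mathcal{B})$ are taken with multiplicity. -}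

module Defs where

open import Data.Integer.Base as ℤ using (ℤ; 0ℤ; 1ℤ; +_)
import Data.Integer.Properties as ℤ
open import Data.Integer.Divisibility.Signed using (divides; _∣?_)
open import Data.List.Base using (List; []; _∷_; _++_; map; concatMap; filter; deduplicate; foldr; length; upTo)
open import Data.List.Membership.Propositional using (_∈_; find; lose)
open import Data.List.Membership.Propositional.Properties using (∈-++⁺ˡ; ∈-++⁺ʳ; ∈-++⁻; ∈-map⁺; ∈-map⁻; ∈-upTo⁺; ∈-concatMap⁺; ∈-concatMap⁻)
open import Data.List.Properties using (∷-injectiveˡ; ∷-injectiveʳ)
open import Data.List.Relation.Binary.Sublist.Propositional using (_⊆_; []; _∷_; _∷ʳ_; minimum)
open import Data.List.Relation.Binary.Sublist.Propositional.Properties using (Any-resp-⊆)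
open import Data.List.Relation.Unary.All as All using (All; []; _∷_)
import Data.List.Relation.Unary.All.Properties as All
open import Data.List.Relation.Unary.AllPairs as AllPairs using (AllPairs; []; _∷_; allPairs?)
import Data.List.Relation.Unary.AllPairs.Properties as AllPairs
open import Data.List.Relation.Unary.Any using (here)
open import Data.List.Relation.Unary.Unique.Propositional using (Unique)
import Data.List.Relation.Unary.Unique.Propositional.Properties as Unique
open import Data.Nat.Base as ℕ using (ℕ; zero; suc; NonZero; _!; s≤s)
open import Data.Nat.ListAction using (sum)
import Data.Nat.Properties as ℕ
open import Data.Product.Base using (_×_; _,_; ∃; proj₁; proj₂; swap)
open import Data.Product.Properties using (≡-dec)
open import Data.Rational.Base as ℚ using (ℚ; 0ℚ; 1ℚ)
import Data.Rational.Properties as ℚ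
open import Data.Sum.Base using (inj₁; inj₂)
open import Function.Base using (_∘_)
open import Function.Bundles using (_⇔_; mk⇔; module Equivalence)
open import Relation.Binary.PropositionalEquality
open import Relation.Nullary using (¬_; Dec; yes; no; contradiction)
open import Relation.Nullary.Decidable using (¬?; _×-dec_; map′)

-- A real number is represented by a Cauchy sequence of rationals; two
-- representatives name the same real when they are related by _≈_.
record ℝ : Set where
  constructor mkℝ
  field
    seq    : ℕ → ℚ
    cauchy : ∀ ε → 0ℚ ℚ.< ε →
             ∃ λ N → ∀ m n → N ℕ.≤ m → N ℕ.≤ n →
             ℚ.∣ seq m ℚ.- seq n ∣ ℚ.< ε

open ℝ public

-- Equality and order of the limits of two sequences.
infix 4 _≈_ _≲_

_≈_ _≲_ : (ℕ → ℚ) → (ℕ → ℚ) → Set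
a ≈ b = ∀ ε → 0ℚ ℚ.< ε → ∃ λ N → ∀ n → N ℕ.≤ n → ℚ.∣ a n ℚ.- b n ∣ ℚ.< ε
a ≲ b = ∀ ε → 0ℚ ℚ.< ε → ∃ λ N → ∀ n → N ℕ.≤ n → a n ℚ.≤ b n ℚ.+ ε

fromℤ : ℤ → ℝ
fromℤ i = mkℝ (λ _ → i ℚ./ 1) λ ε ε>0 →
  0 , λ _ _ _ _ → subst (λ z → ℚ.∣ z ∣ ℚ.< ε) (sym (ℚ.+-inverseʳ (i ℚ./ 1))) ε>0

-- (1 - t) a + t b, computed termwise.
mix : ℝ → ℝ → ℝ → ℕ → ℚ
mix t a b n = (1ℚ ℚ.- seq t n) ℚ.* seq a n ℚ.+ seq t n ℚ.* seq b n

-- Taking t = 0 shows that a convex K is closed under _≈_, so it really is a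
-- set of points of the plane rather than of representatives.
Convex : (ℝ → ℝ → Set) → Set
Convex K = ∀ t x₁ y₁ x₂ y₂ x y →
  (λ _ → 0ℚ) ≲ seq t → seq t ≲ (λ _ → 1ℚ) →
  K x₁ y₁ → K x₂ y₂ →
  seq x ≈ mix t x₁ x₂ → seq y ≈ mix t y₁ y₂ →
  K x y

Bounded : (ℝ → ℝ → Set) → Set
Bounded K = ∃ λ (M : ℝ) → ∀ x y → K x y →
  (λ n → ℚ.∣ seq x n ∣) ≲ seq M × (λ n → ℚ.∣ seq y n ∣) ≲ seq M

Point : Set
Point = ℤ × ℤ

-- The board K ∩ ℤ², given by a list of its points without repetitions.
record ConvexBoard : Set₁ where
  field
    K       : ℝ → ℝ → Set
    bounded : Bounded K
    convex  : Convex K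
    points  : List Point
    unique  : Unique points
    points⇔ : ∀ x y → (x , y) ∈ points ⇔ K (fromℤ x) (fromℤ y)

Attacks : ℤ × ℤ → Point → Point → Set
Attacks (c , d) (x , y) w =
  ∃ λ (k : ℤ) → k ≢ 0ℤ × w ≡ (x ℤ.+ k ℤ.* c , y ℤ.+ k ℤ.* d)

NonAttacking : ℤ × ℤ → List Point → Set
NonAttacking m = AllPairs (λ z w → ¬ Attacks m z w × ¬ Attacks m w z)

-- The sublists of length n; on a repetition-free list they correspond to the
-- n-element subsets, i.e. to the placements of n unlabelled pieces.
combinations : ∀ {A : Set} → ℕ → List A → List (List A)
combinations zero    _        = [] ∷ []
combinations (suc n) []       = []
combinations (suc n) (x ∷ xs) =
  map (x ∷_) (combinations n xs) ++ combinations (suc n) xs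

∈-combinations : ∀ {A : Set} n (xs : List A) {ys} →
                 ys ∈ combinations n xs ⇔ (ys ⊆ xs × length ys ≡ n)
∈-combinations n xs = mk⇔ (to n xs) (λ (s , e) → from n s e)
  where
  to : ∀ n xs {ys} → ys ∈ combinations n xs → ys ⊆ xs × length ys ≡ n
  to zero    xs       (here refl) = minimum xs , refl
  to (suc n) (x ∷ xs) m with ∈-++⁻ (map (x ∷_) (combinations n xs)) m
  ... | inj₂ m₂ = let s , e = to (suc n) xs m₂ in x ∷ʳ s , e
  ... | inj₁ m₁ with ∈-map⁻ (x ∷_) m₁
  ...   | _ , m₀ , refl = let s , e = to n xs m₀ in refl ∷ s , cong suc e

  from : ∀ n {xs ys} → ys ⊆ xs → length ys ≡ n → ys ∈ combinations n xs
  from zero    {ys = []} _          _ = here refl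
  from (suc n) (x ∷ʳ s)             e = ∈-++⁺ʳ _ (from (suc n) s e)
  from (suc n) (_∷_ {x} {xs} refl s) e =
    ∈-++⁺ˡ (∈-map⁺ (x ∷_) (from n s (ℕ.suc-injective e)))

combinations-unique : ∀ {A : Set} n {xs : List A} →
                      Unique xs → Unique (combinations n xs)
combinations-unique zero    _  = [] ∷ []
combinations-unique (suc n) [] = []
combinations-unique (suc n) {x ∷ xs} (x∉ ∷ u) =
  Unique.++⁺ (Unique.map⁺ ∷-injectiveʳ (combinations-unique n u))
             (combinations-unique (suc n) u) disjoint
  where
  disjoint : ∀ {ys} → ¬ (ys ∈ map (x ∷_) (combinations n xs) ×
                         ys ∈ combinations (suc n) xs)
  disjoint (m₁ , m₂) with ∈-map⁻ (x ∷_) m₁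
  ... | _ , _ , refl =
    All.lookup x∉ (Any-resp-⊆ (proj₁ (to m₂)) (here refl)) refl
    where open Equivalence (∈-combinations (suc n) xs)

private
  shift : ∀ {a b k} → b ≡ a ℤ.+ k → b ℤ.- a ≡ k
  shift {a} {k = k} refl = trans (cong (ℤ._- a) (ℤ.+-comm a k))
    (trans (ℤ.+-assoc k a (ℤ.- a))
      (trans (cong (λ j → k ℤ.+ j) (ℤ.+-inverseʳ a)) (ℤ.+-identityʳ k)))

  unshift : ∀ {a b k} → b ℤ.- a ≡ k → b ≡ a ℤ.+ k
  unshift {a} {b} refl = sym (trans (ℤ.+-comm a _)
    (trans (ℤ.+-assoc b (ℤ.- a) a)
      (trans (cong (λ j → b ℤ.+ j) (ℤ.+-inverseˡ a)) (ℤ.+-identityʳ b))))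

  attacks-d≢0? : ∀ {c d} → d ≢ 0ℤ → ∀ z w → Dec (Attacks (c , d) z w)
  attacks-d≢0? {c} {d} d≢0 (x , y) (x′ , y′) with d ∣? (y′ ℤ.- y)
  ... | no ∤ = no λ (k , _ , e) → ∤ (divides k (shift (cong proj₂ e)))
  ... | yes (divides k e) = map′
    (λ (k≢0 , ex) → k , k≢0 , cong₂ _,_ ex (unshift e))
    (λ (j , j≢0 , ew) →
      let j≡k = ℤ.*-cancelʳ-≡ j k d ⦃ ℤ.≢-nonZero d≢0 ⦄
                  (trans (sym (shift (cong proj₂ ew))) e)
      in subst (λ i → i ≢ 0ℤ × x′ ≡ x ℤ.+ i ℤ.* c) j≡k (j≢0 , cong proj₁ ew))
    (¬? (k ℤ.≟ 0ℤ) ×-dec (x′ ℤ.≟ x ℤ.+ k ℤ.* c))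

  attacks-swap : ∀ m z w → Attacks (swap m) (swap z) (swap w) → Attacks m z w
  attacks-swap _ _ _ (k , k≢0 , e) = k , k≢0 , cong swap e

attacks? : ∀ m z w → Dec (Attacks m z w)
attacks? (c , d) z w with d ℤ.≟ 0ℤ | c ℤ.≟ 0ℤ
... | no d≢0   | _        = attacks-d≢0? d≢0 z w
... | yes _    | no c≢0   =
  map′ (attacks-swap (c , d) z w) (attacks-swap (d , c) (swap z) (swap w))
       (attacks-d≢0? c≢0 (swap z) (swap w))
attacks? _ (x , y) w | yes refl | yes refl = map′
  (λ e → 1ℤ , (λ ()) , trans e (sym (fixed 1ℤ)))
  (λ (k , _ , e) → trans e (fixed k))
  (≡-dec ℤ._≟_ ℤ._≟_ w (x , y))
  where
  fixed : ∀ k → (x ℤ.+ k ℤ.* 0ℤ , y ℤ.+ k ℤ.* 0ℤ) ≡ (x , y)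
  fixed k rewrite ℤ.*-zeroʳ k = cong₂ _,_ (ℤ.+-identityʳ x) (ℤ.+-identityʳ y)

nonAttacking? : ∀ m zs → Dec (NonAttacking m zs)
nonAttacking? m =
  allPairs? (λ z w → ¬? (attacks? m z w) ×-dec ¬? (attacks? m w z))

u : ℤ × ℤ → ℕ → ConvexBoard → ℕ
u m q B = length (filter (nonAttacking? m) (combinations q points))
  where open ConvexBoard B

-- The points (x , y) with lineIndex (c , d) (x , y) ≡ b form the line l(b).
lineIndex : ℤ × ℤ → Point → ℤ
lineIndex (c , d) (x , y) = d ℤ.* x ℤ.- c ℤ.* y

line : ℤ × ℤ → ConvexBoard → ℤ → List Point
line m B b = filter (λ z → lineIndex m z ℤ.≟ b) (ConvexBoard.points B)

-- One entry for each b that is the index of some point of the board, i.e. for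
-- which the line is nonempty; the order of the list is irrelevant.
lineSizes : ℤ × ℤ → ConvexBoard → List ℕ
lineSizes m B =
  map (λ b → length (line m B b))
      (deduplicate ℤ._≟_ (map (lineIndex m) (ConvexBoard.points B)))

-- A part λᵢ together with its multiplicity nᵢ, both positive.
record Block : Set where
  constructor _^^_
  field
    part : ℕ
    mult : ℕ
    .⦃ part≢0 ⦄ : NonZero part
    .⦃ mult≢0 ⦄ : NonZero mult

open Block public

weight : Block → ℕ
weight b = mult b ℕ.* part b

-- The distinct parts are listed in decreasing order, so that each partition
-- is represented exactly once.
IsPartition : ℕ → List Block → Set
IsPartition q p =
  AllPairs (λ a b → part b ℕ.< part a) p × sum (map weight p) ≡ q

-- The partitions of q into parts at most m.
partitions≤ : ℕ → ℕ → List (List Block)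
withBlock   : ℕ → ℕ → ℕ → List (List Block)

partitions≤ zero    zero    = [] ∷ []
partitions≤ zero    (suc _) = []
partitions≤ (suc m) q =
  partitions≤ m q ++ concatMap (withBlock m q) (upTo q)

-- Those in which the part suc m occurs exactly suc n times.
withBlock m q n with suc n ℕ.* suc m ℕ.≤? q
... | yes _ = map ((suc m ^^ suc n) ∷_) (partitions≤ m (q ℕ.∸ suc n ℕ.* suc m))
... | no  _ = []

partitions : ℕ → List (List Block)
partitions q = partitions≤ q q

private
  Bounded≤ : ℕ → List Block → Set
  Bounded≤ m = All (λ b → part b ℕ.≤ m)

  withBlock⁻ : ∀ m q n {p} → p ∈ withBlock m q n →
    ∃ λ p′ → p ≡ (suc m ^^ suc n) ∷ p′ × suc n ℕ.* suc m ℕ.≤ q ×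
             p′ ∈ partitions≤ m (q ℕ.∸ suc n ℕ.* suc m)
  withBlock⁻ m q n ∈p with suc n ℕ.* suc m ℕ.≤? q
  ... | yes le = let p′ , ∈p′ , e = ∈-map⁻ _ ∈p in p′ , e , le , ∈p′

  withBlock⁺ : ∀ m q n {p} → suc n ℕ.* suc m ℕ.≤ q →
    p ∈ partitions≤ m (q ℕ.∸ suc n ℕ.* suc m) →
    ((suc m ^^ suc n) ∷ p) ∈ withBlock m q n
  withBlock⁺ m q n le ∈p with suc n ℕ.* suc m ℕ.≤? q
  ... | yes _  = ∈-map⁺ _ ∈p
  ... | no  ≰  = contradiction le ≰

  sound : ∀ m q {p} → p ∈ partitions≤ m q → IsPartition q p × Bounded≤ m p
  sound zero zero (here refl) = ([] , refl) , []
  sound (suc m) q ∈p with ∈-++⁻ (partitions≤ m q) ∈p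
  ... | inj₁ ∈₁ = let h , bd = sound m q ∈₁ in h , All.map ℕ.m≤n⇒m≤1+n bd
  ... | inj₂ ∈₂ with find (∈-concatMap⁻ (withBlock m q) {xs = upTo q} ∈₂)
  ...   | n , _ , ∈b with withBlock⁻ m q n ∈b
  ...     | p′ , refl , le , ∈p′ with sound m _ ∈p′
  ...       | (dec , s) , bd =
    ( All.map s≤s bd ∷ dec
    , trans (cong (λ j → suc n ℕ.* suc m ℕ.+ j) s) (ℕ.m+[n∸m]≡n le)) ,
    ℕ.≤-refl ∷ All.map ℕ.m≤n⇒m≤1+n bd

  complete : ∀ m q p → IsPartition q p → Bounded≤ m p → p ∈ partitions≤ m q
  complete zero q [] ([] , refl) _ = here refl
  complete zero q ((suc _ ^^ _) ∷ _) _ (() ∷ _)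
  complete (suc m) q [] h _ = ∈-++⁺ˡ (complete m q [] h [])
  complete (suc m) q (b ∷ p) h (le ∷ bd) with ℕ.m≤n⇒m<n∨m≡n le
  complete (suc m) q (b ∷ p) h@(lt ∷ _ , _) _ | inj₁ b< =
    ∈-++⁺ˡ (complete m q (b ∷ p) h
      (ℕ.≤-pred b< ∷ All.map (λ l → ℕ.≤-trans (ℕ.<⇒≤ l) (ℕ.≤-pred b<)) lt))
  complete (suc m) q ((_ ^^ suc n) ∷ p) (lt ∷ dec , refl) _ | inj₂ refl =
    ∈-++⁺ʳ (partitions≤ m q) (∈-concatMap⁺ (withBlock m q)
      (lose (∈-upTo⁺ n<q) (withBlock⁺ m q n w≤q
        (complete m _ p (dec , sym (ℕ.m+n∸m≡n w _)) (All.map ℕ.≤-pred lt)))))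
    where
    w = suc n ℕ.* suc m
    w≤q : w ℕ.≤ q
    w≤q = ℕ.m≤m+n w _
    n<q : n ℕ.< q
    n<q = ℕ.≤-trans (ℕ.m≤m*n (suc n) (suc m)) w≤q

  weights-bound : ∀ q p → sum (map weight p) ℕ.≤ q → Bounded≤ q p
  weights-bound q []      _ = []
  weights-bound q (b ∷ p) h =
    ℕ.≤-trans (ℕ.m≤n*m (part b) (mult b))
      (ℕ.≤-trans (ℕ.m≤m+n (weight b) _) h) ∷
    weights-bound q p (ℕ.≤-trans (ℕ.m≤n+m _ (weight b)) h)

  withBlock-unique : ∀ m q n → Unique (partitions≤ m (q ℕ.∸ suc n ℕ.* suc m)) →
                     Unique (withBlock m q n)
  withBlock-unique m q n h with suc n ℕ.* suc m ℕ.≤? q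
  ... | yes _ = Unique.map⁺ ∷-injectiveʳ h
  ... | no  _ = []

  partitions≤-unique : ∀ m q → Unique (partitions≤ m q)
  partitions≤-unique zero    zero    = [] ∷ []
  partitions≤-unique zero    (suc _) = []
  partitions≤-unique (suc m) q =
    Unique.++⁺ (partitions≤-unique m q)
      (Unique.concat⁺
        (All.map⁺ (All.universal
          (λ n → withBlock-unique m q n (partitions≤-unique m _)) (upTo q)))
        (AllPairs.map⁺ (AllPairs.map apart (Unique.upTo⁺ q))))
      disjoint
    where
    apart : ∀ {i j} → i ≢ j →
            ∀ {p} → ¬ (p ∈ withBlock m q i × p ∈ withBlock m q j)
    apart {i} {j} i≢j (∈i , ∈j) with withBlock⁻ m q i ∈i | withBlock⁻ m q j ∈j
    ... | _ , refl , _ | _ , e , _ =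
      i≢j (ℕ.suc-injective (cong mult (∷-injectiveˡ e)))
    disjoint : ∀ {p} → ¬ (p ∈ partitions≤ m q ×
                          p ∈ concatMap (withBlock m q) (upTo q))
    disjoint (∈₁ , ∈₂)
      with find (∈-concatMap⁻ (withBlock m q) {xs = upTo q} ∈₂)
    ... | n , _ , ∈b with withBlock⁻ m q n ∈b
    ...   | _ , refl , _ = ℕ.1+n≰n (All.head (proj₂ (sound m q ∈₁)))

∈-partitions : ∀ q {p} → p ∈ partitions q ⇔ IsPartition q p
∈-partitions q {p} = mk⇔ (proj₁ ∘ sound q q)
  λ h → complete q q p h (weights-bound q p (ℕ.≤-reflexive (proj₂ h)))

partitions-unique : ∀ q → Unique (partitions q)
partitions-unique q = partitions≤-unique q q

sumℚ productℚ : List ℚ → ℚ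
sumℚ     = foldr ℚ._+_ 0ℚ
productℚ = foldr ℚ._*_ 1ℚ

infixr 8 _^ℚ_

_^ℚ_ : ℚ → ℕ → ℚ
x ^ℚ zero  = 1ℚ
x ^ℚ suc n = x ℚ.* x ^ℚ n

coefficient : Block → ℚ
coefficient (l ^^ n) = ℚ._/_ 1ℤ (l ℕ.^ n ℕ.* n !)
  ⦃ ℕ.m*n≢0 _ _ ⦃ ℕ.m^n≢0 l n ⦄ ⦃ n ℕ.!≢0 ⦄ ⦄

powerSum : ℕ → List ℕ → ℚ
powerSum k ls = sumℚ (map (λ l → (+ l ℚ./ 1) ^ℚ k) ls)

{-# OPTIONS --safe #-}

-- Two distinct board points attack each other exactly when they lie on the same
-- line of direction (c , d), so a nonattacking configuration picks at most one
-- point from each line, and u is the elementary symmetric polynomial e_q of the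
-- line sizes.  It remains to expand e_q in power sums p_k.  With θ = x d/dx,
-- both E = Σ e_q x^q and exp (Σ (-1)^(k-1) p_k x^k / k) have constant term 1 and
-- satisfy θ F = (Σ (-1)^(k-1) p_k x^k) F, an equation which determines F; the
-- coefficient of x^q in the exponential is the sum over the partitions of q.

module Submission where

open import Defs
open import Data.Integer using (ℤ; 0ℤ; +_; _≤_)
open import Data.Integer.Coprimality using (Coprime)
open import Data.List using (map)
open import Data.Nat using (ℕ; _∸_)
open import Data.Nat.ListAction using (sum)
open import Data.Product using (_,_)
open import Data.Rational using (ℚ; 1ℚ; _/_; _*_; -_)
open import Relation.Binary.PropositionalEquality using (_≡_)
import Data.Nat as ℕ

open import Data.Integer.Base as ℤ using (1ℤ)
open import Data.Integer.Coprimality using (coprime-divisor)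
open import Data.Integer.Divisibility.Signed using (_∣_; divides; ∣⇒∣ᵤ; ∣ᵤ⇒∣)
import Data.Integer.Properties as ℤ
import Data.Integer.Tactic.RingSolver as ℤ-Solver
open import Data.List.Base using
  (List; []; _∷_; _++_; filter; deduplicate; length; concatMap; applyUpTo; upTo)
open import Data.List.Membership.Propositional using (_∈_)
open import Data.List.Properties using
  (length-map; filter-++; length-++; filter-≐; filter-accept; filter-reject; filter-none;
   length-filter; map-cong-local; map-upTo; map-∘; ++-identityʳ)
open import Data.List.Relation.Binary.Sublist.Propositional using (_⊆_; []; _∷_; _∷ʳ_)
open import Data.List.Relation.Binary.Sublist.Propositional.Properties using (All-resp-⊆)
open import Data.List.Relation.Unary.All as All using (All; []; _∷_; all?)
import Data.List.Relation.Unary.All.Properties as All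
open import Data.List.Relation.Unary.AllPairs as AllPairs using (AllPairs; []; _∷_; allPairs?)
open import Data.Nat.Base using (zero; suc; pred; NonZero; _!; z≤n; s≤s)
open import Data.Nat.Divisibility using (_∣0)
open import Data.Nat.Induction using (<-rec; <-wellFounded)
import Data.Nat.Properties as ℕ
import Data.Nat.Tactic.RingSolver as ℕ-Solver
open import Data.Product.Base using (_×_; proj₁; proj₂)
open import Data.Rational using (0ℚ; _+_; toℚᵘ)
import Data.Rational.Properties as ℚ
open import Data.Rational.Solver using (module +-*-Solver)
import Data.Rational.Unnormalised.Base as ℚᵘ
import Data.Rational.Unnormalised.Properties as ℚᵘ
open import Function.Base using (_∘_)
open import Function.Bundles using (module Equivalence)
open import Induction.WellFounded using (Acc; acc)
open import Relation.Binary.Definitions using (DecidableEquality)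
open import Relation.Binary.PropositionalEquality using
  (_≢_; refl; sym; trans; cong; cong₂; subst; module ≡-Reasoning)
open import Relation.Nullary using (¬_; yes; no; contradiction)
open import Relation.Nullary.Decidable using (¬?; _×-dec_)
open import Relation.Unary using (Decidable)
open +-*-Solver using (solve; _:=_; _:+_; _:*_; :-_; con)

-- Rainbow subsets of a coloured list

-- The count and the polynomial recurse differently: `combinations` walks through the points,
-- whereas `elementary` takes one line at a time, and the points of a line are scattered over the
-- list. `rainbows-split` reconciles the two by taking a whole colour out of the list at once. On
-- the series side no infinite sum or product is formed. The exponential is built one part size at a
-- time: admitting the part m+1 multiplies the series by exp (a x^(m+1)), whose i-th term accounts
-- for the partitions containing that part exactly i times, and `partitions≤` follows the same
-- recursion. Each finite stage solves the equation with a truncated right-hand side, and stage q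
-- already has the right coefficients up to x^q. The sign is distributed over the blocks by q - Σ nᵢ
-- = Σ nᵢ (λᵢ - 1).

private variable
  A B : Set

filter-map : ∀ {P : B → Set} (P? : Decidable P) (f : A → B) xs →
             filter P? (map f xs) ≡ map f (filter (P? ∘ f) xs)
filter-map P? f []       = refl
filter-map P? f (x ∷ xs) with P? (f x)
... | yes _ = cong (f x ∷_) (filter-map P? f xs)
... | no  _ = filter-map P? f xs

filter-filter : ∀ {P Q : A → Set} (P? : Decidable P) (Q? : Decidable Q) xs →
                filter P? (filter Q? xs) ≡ filter (λ x → Q? x ×-dec P? x) xs
filter-filter P? Q? []       = refl
filter-filter P? Q? (x ∷ xs) with Q? x
... | no _  = filter-filter P? Q? xs
... | yes _ with P? x
...   | yes _ = cong (x ∷_) (filter-filter P? Q? xs)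
...   | no  _ = filter-filter P? Q? xs

filter-comm : ∀ {P Q : A → Set} (P? : Decidable P) (Q? : Decidable Q) xs →
              filter P? (filter Q? xs) ≡ filter Q? (filter P? xs)
filter-comm P? Q? xs = trans (filter-filter P? Q? xs)
  (trans (filter-≐ (λ x → Q? x ×-dec P? x) (λ x → P? x ×-dec Q? x)
            ((λ (q , p) → p , q) , (λ (p , q) → q , p)) xs)
         (sym (filter-filter Q? P? xs)))

-- The equivalence is asked only of members: nonattacking and rainbow are compared only for sublists
-- of the repetition-free list of board points.
filter-cong-∈ : ∀ {P Q : A → Set} (P? : Decidable P) (Q? : Decidable Q) {xs} →
                All (λ x → (P x → Q x) × (Q x → P x)) xs →
                filter P? xs ≡ filter Q? xs
filter-cong-∈ P? Q? []       = refl
filter-cong-∈ P? Q? {x ∷ _} ((to , from) ∷ h) with P? x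
... | yes p = trans (cong (x ∷_) (filter-cong-∈ P? Q? h)) (sym (filter-accept Q? (to p)))
... | no ¬p = trans (filter-cong-∈ P? Q? h) (sym (filter-reject Q? (¬p ∘ from)))

-- Equal elements satisfy `P` together. If `x` fails `P`, the copies of `x` that deduplication drops
-- would be filtered out anyway.
deduplicate-filter : ∀ {P : A → Set} (_≟_ : DecidableEquality A) (P? : Decidable P) xs →
                     filter P? (deduplicate _≟_ xs) ≡ deduplicate _≟_ (filter P? xs)
deduplicate-filter _≟_ P? []       = refl
deduplicate-filter {P = P} _≟_ P? (x ∷ xs) with P? x
... | yes _ = cong (x ∷_) (trans (filter-comm P? (¬? ∘ (x ≟_)) (deduplicate _≟_ xs))
                (cong (filter (¬? ∘ (x ≟_))) (deduplicate-filter _≟_ P? xs)))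
... | no ¬p = trans (filter-filter P? (¬? ∘ (x ≟_)) (deduplicate _≟_ xs))
    (trans (filter-≐ (λ y → ¬? (x ≟ y) ×-dec P? y) P?
             (proj₂ , λ p → (λ x≡y → ¬p (subst P (sym x≡y) p)) , p) (deduplicate _≟_ xs))
           (deduplicate-filter _≟_ P? xs))

-- Turns a condition on every member of a chosen sublist into a smaller list to choose from; in
-- `rainbows-∷` the condition is to avoid the colour of the head.
combinations-filter : ∀ {P : A → Set} (P? : Decidable P) n xs →
                      filter (all? P?) (combinations n xs) ≡ combinations n (filter P? xs)
combinations-filter P? zero    xs       = refl
combinations-filter P? (suc n) []       = refl
combinations-filter P? (suc n) (x ∷ xs) =
  trans (filter-++ (all? P?) (map (x ∷_) (combinations n xs)) (combinations (suc n) xs))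
        (step (P? x))
  where
  step : ∀ d → filter (all? P?) (map (x ∷_) (combinations n xs)) ++
               filter (all? P?) (combinations (suc n) xs) ≡
               combinations (suc n) (filter P? (x ∷ xs))
  step (yes p) rewrite filter-accept P? {xs = xs} p = cong₂ _++_
    (trans (filter-map (all? P?) (x ∷_) (combinations n xs))
      (cong (map (x ∷_))
        (trans (filter-≐ (all? P? ∘ (x ∷_)) (all? P?) (All.tail , p ∷_) (combinations n xs))
               (combinations-filter P? n xs))))
    (combinations-filter P? (suc n) xs)
  step (no ¬p) rewrite filter-reject P? {xs = xs} ¬p = cong₂ _++_
    (filter-none (all? P?) (All.map⁺ (All.universal (λ _ → ¬p ∘ All.head) (combinations n xs))))
    (combinations-filter P? (suc n) xs)

elementary : ℕ → List ℕ → ℕ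
elementary zero    _        = 1
elementary (suc q) []       = 0
elementary (suc q) (l ∷ ls) = l ℕ.* elementary q ls ℕ.+ elementary (suc q) ls

module Colouring {K : Set} (_≟_ : DecidableEquality K) (κ : A → K) where

  infixl 5 _∖_

  -- The test is oriented as in `deduplicate`, so that in `sizes-∷` the filtered list of colours is
  -- definitionally the one belonging to the smaller list.
  _∖_ : List A → K → List A
  xs ∖ k = filter (λ z → ¬? (k ≟ κ z)) xs

  size : K → List A → ℕ
  size k xs = length (filter (λ z → κ z ≟ k) xs)

  -- With `κ` the line index and `xs` the board points this unfolds to `lineSizes`.
  sizes : List A → List ℕ
  sizes xs = map (λ k → size k xs) (deduplicate _≟_ (map κ xs))

  Rainbow : List A → Set
  Rainbow = AllPairs (λ z w → ¬ κ z ≡ κ w)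

  rainbow? : Decidable Rainbow
  rainbow? = allPairs? (λ z w → ¬? (κ z ≟ κ w))

  rainbows : ℕ → List A → ℕ
  rainbows n xs = length (filter rainbow? (combinations n xs))

  rainbows-∷ : ∀ n x xs →
               rainbows (suc n) (x ∷ xs) ≡ rainbows n (xs ∖ κ x) ℕ.+ rainbows (suc n) xs
  rainbows-∷ n x xs = begin
    length (filter rainbow? (map (x ∷_) (combinations n xs) ++ combinations (suc n) xs))
      ≡⟨ cong length (filter-++ rainbow? (map (x ∷_) (combinations n xs)) _) ⟩
    length (filter rainbow? (map (x ∷_) (combinations n xs)) ++ _)
      ≡⟨ length-++ (filter rainbow? (map (x ∷_) (combinations n xs))) ⟩
    length (filter rainbow? (map (x ∷_) (combinations n xs))) ℕ.+ rainbows (suc n) xs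
      ≡⟨ cong (λ zs → length zs ℕ.+ rainbows (suc n) xs)
           (filter-map rainbow? (x ∷_) (combinations n xs)) ⟩
    length (map (x ∷_) (filter (rainbow? ∘ (x ∷_)) (combinations n xs))) ℕ.+ rainbows (suc n) xs
      ≡⟨ cong (ℕ._+ rainbows (suc n) xs)
           (length-map (x ∷_) (filter (rainbow? ∘ (x ∷_)) (combinations n xs))) ⟩
    length (filter (rainbow? ∘ (x ∷_)) (combinations n xs)) ℕ.+ rainbows (suc n) xs
      ≡⟨ cong (λ zs → length zs ℕ.+ rainbows (suc n) xs)
           (filter-≐ (rainbow? ∘ (x ∷_)) (λ ys → all? apart? ys ×-dec rainbow? ys)
             ((λ { (h ∷ t) → h , t }) , λ (h , t) → h ∷ t) (combinations n xs)) ⟩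
    length (filter (λ ys → all? apart? ys ×-dec rainbow? ys) (combinations n xs)) ℕ.+ rainbows (suc n) xs
      ≡⟨ cong (λ zs → length zs ℕ.+ rainbows (suc n) xs)
           (filter-filter rainbow? (all? apart?) (combinations n xs)) ⟨
    length (filter rainbow? (filter (all? apart?) (combinations n xs))) ℕ.+ rainbows (suc n) xs
      ≡⟨ cong (λ zs → length (filter rainbow? zs) ℕ.+ rainbows (suc n) xs)
           (combinations-filter apart? n xs) ⟩
    rainbows n (xs ∖ κ x) ℕ.+ rainbows (suc n) xs ∎
    where
    open ≡-Reasoning
    apart? = λ z → ¬? (κ x ≟ κ z)

  size-∖ : ∀ {k j} → ¬ j ≡ k → ∀ xs → size k (xs ∖ j) ≡ size k xs
  size-∖ {k} {j} j≢k xs = cong length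
    (trans (filter-filter (λ z → κ z ≟ k) (λ z → ¬? (j ≟ κ z)) xs)
           (filter-≐ (λ z → ¬? (j ≟ κ z) ×-dec (κ z ≟ k)) (λ z → κ z ≟ k)
             (proj₂ , λ e → (λ j≡ → j≢k (trans j≡ e)) , e) xs))

  size-same : ∀ {k x} → k ≡ κ x → ∀ xs → size k (x ∷ xs) ≡ suc (size k xs)
  size-same e xs = cong length (filter-accept (λ z → κ z ≟ _) (sym e))

  size-other : ∀ {k x} → ¬ k ≡ κ x → ∀ xs → size k (x ∷ xs) ≡ size k xs
  size-other ne xs = cong length (filter-reject (λ z → κ z ≟ _) (ne ∘ sym))

  ∖-same : ∀ {k x} → k ≡ κ x → ∀ xs → (x ∷ xs) ∖ k ≡ xs ∖ k
  ∖-same e xs = filter-reject (λ z → ¬? (_ ≟ κ z)) (λ ne → ne e)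

  ∖-comm : ∀ j k xs → xs ∖ j ∖ k ≡ xs ∖ k ∖ j
  ∖-comm j k = filter-comm (λ z → ¬? (k ≟ κ z)) (λ z → ¬? (j ≟ κ z))

  -- At most one member of a rainbow list has the colour k.
  rainbows-split : ∀ n k xs →
    rainbows (suc n) xs ≡ size k xs ℕ.* rainbows n (xs ∖ k) ℕ.+ rainbows (suc n) (xs ∖ k)
  rainbows-split n k [] = refl
  rainbows-split n k (x ∷ xs) with k ≟ κ x
  ... | yes refl = begin
    rainbows (suc n) (x ∷ xs)
      ≡⟨ rainbows-∷ n x xs ⟩
    r ℕ.+ rainbows (suc n) xs
      ≡⟨ cong (λ t → r ℕ.+ t) (rainbows-split n k xs) ⟩
    r ℕ.+ (size k xs ℕ.* r ℕ.+ rainbows (suc n) (xs ∖ k))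
      ≡⟨ ℕ.+-assoc r _ _ ⟨
    suc (size k xs) ℕ.* r ℕ.+ rainbows (suc n) (xs ∖ k)
      ≡⟨ cong (λ s → s ℕ.* r ℕ.+ rainbows (suc n) (xs ∖ k)) (size-same refl xs) ⟨
    size k (x ∷ xs) ℕ.* r ℕ.+ rainbows (suc n) (xs ∖ k) ∎
    where
    open ≡-Reasoning
    r = rainbows n (xs ∖ k)
  -- For a head of another colour the lists through it have to be split again at `k`, which requires
  -- that a further member be chosen; lists of length one are therefore treated apart.
  rainbows-split zero k (x ∷ xs) | no ne = begin
    rainbows 1 (x ∷ xs)
      ≡⟨ rainbows-∷ 0 x xs ⟩
    1 ℕ.+ rainbows 1 xs
      ≡⟨ cong suc (rainbows-split 0 k xs) ⟩
    1 ℕ.+ (size k xs ℕ.* 1 ℕ.+ rainbows 1 (xs ∖ k))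
      ≡⟨ swap (size k xs) (rainbows 1 (xs ∖ k)) ⟩
    size k xs ℕ.* 1 ℕ.+ (1 ℕ.+ rainbows 1 (xs ∖ k))
      ≡⟨ cong₂ (λ s t → s ℕ.* 1 ℕ.+ t) (size-other ne xs) (rainbows-∷ 0 x (xs ∖ k)) ⟨
    size k (x ∷ xs) ℕ.* 1 ℕ.+ rainbows 1 (x ∷ (xs ∖ k)) ∎
    where
    open ≡-Reasoning
    swap : ∀ s t → 1 ℕ.+ (s ℕ.* 1 ℕ.+ t) ≡ s ℕ.* 1 ℕ.+ (1 ℕ.+ t)
    swap = ℕ-Solver.solve-∀
  rainbows-split (suc n) k (x ∷ xs) | no ne = begin
    rainbows (2 ℕ.+ n) (x ∷ xs)
      ≡⟨ rainbows-∷ (suc n) x xs ⟩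
    rainbows (suc n) (xs ∖ κ x) ℕ.+ rainbows (2 ℕ.+ n) xs
      -- The first call is on a list that is not structurally smaller, but its `n` has dropped; the
      -- second keeps `n` and shortens the list.
      ≡⟨ cong₂ ℕ._+_ (rainbows-split n k (xs ∖ κ x)) (rainbows-split (suc n) k xs) ⟩
    size k (xs ∖ κ x) ℕ.* rainbows n (xs ∖ κ x ∖ k) ℕ.+ rainbows (suc n) (xs ∖ κ x ∖ k) ℕ.+
    (size k xs ℕ.* rainbows (suc n) (xs ∖ k) ℕ.+ rainbows (2 ℕ.+ n) (xs ∖ k))
      ≡⟨ cong₂ (λ s ys → s ℕ.* rainbows n ys ℕ.+ rainbows (suc n) ys ℕ.+
                  (size k xs ℕ.* rainbows (suc n) (xs ∖ k) ℕ.+ rainbows (2 ℕ.+ n) (xs ∖ k)))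
           (size-∖ (ne ∘ sym) xs) (∖-comm (κ x) k xs) ⟩
    size k xs ℕ.* a ℕ.+ b ℕ.+ (size k xs ℕ.* c ℕ.+ d)
      ≡⟨ regroup (size k xs) a b c d ⟩
    size k xs ℕ.* (a ℕ.+ c) ℕ.+ (b ℕ.+ d)
      ≡⟨ cong₂ (λ s t → size k xs ℕ.* s ℕ.+ t)
           (rainbows-∷ n x (xs ∖ k)) (rainbows-∷ (suc n) x (xs ∖ k)) ⟨
    size k xs ℕ.* rainbows (suc n) (x ∷ (xs ∖ k)) ℕ.+ rainbows (2 ℕ.+ n) (x ∷ (xs ∖ k))
      ≡⟨ cong (λ s → s ℕ.* rainbows (suc n) (x ∷ (xs ∖ k)) ℕ.+ rainbows (2 ℕ.+ n) (x ∷ (xs ∖ k)))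
           (size-other ne xs) ⟨
    size k (x ∷ xs) ℕ.* rainbows (suc n) (x ∷ (xs ∖ k)) ℕ.+ rainbows (2 ℕ.+ n) (x ∷ (xs ∖ k)) ∎
    where
    open ≡-Reasoning
    a = rainbows n (xs ∖ k ∖ κ x)
    b = rainbows (suc n) (xs ∖ k ∖ κ x)
    c = rainbows (suc n) (xs ∖ k)
    d = rainbows (2 ℕ.+ n) (xs ∖ k)
    regroup : ∀ s a b c d → s ℕ.* a ℕ.+ b ℕ.+ (s ℕ.* c ℕ.+ d) ≡ s ℕ.* (a ℕ.+ c) ℕ.+ (b ℕ.+ d)
    regroup = ℕ-Solver.solve-∀

  sizes-∷ : ∀ x xs → sizes (x ∷ xs) ≡ suc (size (κ x) xs) ∷ sizes (xs ∖ κ x)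
  sizes-∷ x xs = cong₂ _∷_ (size-same refl xs) (begin
    map (λ k → size k (x ∷ xs)) (filter ≢x (deduplicate _≟_ (map κ xs)))
      ≡⟨ map-cong-local (All.map (λ {k} x≢k → trans (size-other (x≢k ∘ sym) xs)
                                                  (sym (size-∖ x≢k xs)))
           (All.all-filter ≢x (deduplicate _≟_ (map κ xs)))) ⟩
    map (λ k → size k (xs ∖ κ x)) (filter ≢x (deduplicate _≟_ (map κ xs)))
      ≡⟨ cong (map _) (deduplicate-filter _≟_ ≢x (map κ xs)) ⟩
    map (λ k → size k (xs ∖ κ x)) (deduplicate _≟_ (filter ≢x (map κ xs)))
      ≡⟨ cong (λ ks → map (λ k → size k (xs ∖ κ x)) (deduplicate _≟_ ks)) (filter-map ≢x κ xs) ⟩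
    sizes (xs ∖ κ x) ∎)
    where
    open ≡-Reasoning
    ≢x = ¬? ∘ (κ x ≟_)

  -- Splitting at the colour of the head removes its whole class, and by `sizes-∷` the other classes
  -- keep their sizes, which is one step of `elementary`. The induction is on length, as removing a
  -- class is not structural.
  rainbows≡elementary : ∀ n xs → rainbows n xs ≡ elementary n (sizes xs)
  rainbows≡elementary n xs = go n xs (<-wellFounded (length xs))
    where
    open ≡-Reasoning
    go : ∀ n xs → Acc ℕ._<_ (length xs) → rainbows n xs ≡ elementary n (sizes xs)
    go zero    xs       _         = refl
    go (suc n) []       _         = refl
    go (suc n) (x ∷ xs) (acc rec) = begin
      rainbows (suc n) (x ∷ xs)
        ≡⟨ rainbows-split n (κ x) (x ∷ xs) ⟩
      size (κ x) (x ∷ xs) ℕ.* rainbows n ((x ∷ xs) ∖ κ x) ℕ.+ rainbows (suc n) ((x ∷ xs) ∖ κ x)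
        ≡⟨ cong₂ (λ s ys → s ℕ.* rainbows n ys ℕ.+ rainbows (suc n) ys)
             (size-same refl xs) (∖-same refl xs) ⟩
      suc (size (κ x) xs) ℕ.* rainbows n (xs ∖ κ x) ℕ.+ rainbows (suc n) (xs ∖ κ x)
        ≡⟨ cong₂ (λ s t → suc (size (κ x) xs) ℕ.* s ℕ.+ t)
             (go n (xs ∖ κ x) (rec smaller)) (go (suc n) (xs ∖ κ x) (rec smaller)) ⟩
      elementary (suc n) (suc (size (κ x) xs) ∷ sizes (xs ∖ κ x))
        ≡⟨ cong (elementary (suc n)) (sizes-∷ x xs) ⟨
      elementary (suc n) (sizes (x ∷ xs)) ∎
      where
      smaller = s≤s (length-filter (λ z → ¬? (κ x ≟ κ z)) xs)

-- Natural numbers and their inverses in ℚ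

fromℕ : ℕ → ℚ
fromℕ n = + n / 1

recip : (n : ℕ) .⦃ _ : NonZero n ⦄ → ℚ
recip n = 1ℤ / n

private
  fromℕᵘ : ℕ → ℚᵘ.ℚᵘ
  fromℕᵘ n = ℚᵘ.mkℚᵘ (+ n) 0

-- Proved on unnormalised rationals, where equality is cross-multiplication and no gcd has to be
-- cancelled.
fromℕ-+ : ∀ m n → fromℕ (m ℕ.+ n) ≡ fromℕ m + fromℕ n
fromℕ-+ m n = ℚ.toℚᵘ-injective (begin-equality
  toℚᵘ (fromℕ (m ℕ.+ n))                ≃⟨ ℚ.toℚᵘ-fromℚᵘ (fromℕᵘ (m ℕ.+ n)) ⟩
  fromℕᵘ (m ℕ.+ n)
    ≃⟨ ℚᵘ.*≡* (cong (ℤ._* + 1) (trans (ℤ.pos-+ m n)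
           (cong₂ ℤ._+_ (sym (ℤ.*-identityʳ (+ m))) (sym (ℤ.*-identityʳ (+ n)))))) ⟩
  fromℕᵘ m ℚᵘ.+ fromℕᵘ n
    ≃⟨ ℚᵘ.+-cong (ℚ.toℚᵘ-fromℚᵘ (fromℕᵘ m)) (ℚ.toℚᵘ-fromℚᵘ (fromℕᵘ n)) ⟨
  toℚᵘ (fromℕ m) ℚᵘ.+ toℚᵘ (fromℕ n)  ≃⟨ ℚ.toℚᵘ-homo-+ (fromℕ m) (fromℕ n) ⟨
  toℚᵘ (fromℕ m + fromℕ n)              ∎)
  where open ℚᵘ.≤-Reasoning

fromℕ-* : ∀ m n → fromℕ (m ℕ.* n) ≡ fromℕ m * fromℕ n
fromℕ-* m n = ℚ.toℚᵘ-injective (begin-equality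
  toℚᵘ (fromℕ (m ℕ.* n))                ≃⟨ ℚ.toℚᵘ-fromℚᵘ (fromℕᵘ (m ℕ.* n)) ⟩
  fromℕᵘ (m ℕ.* n)                        ≃⟨ ℚᵘ.*≡* (cong (ℤ._* + 1) (ℤ.pos-* m n)) ⟩
  fromℕᵘ m ℚᵘ.* fromℕᵘ n
    ≃⟨ ℚᵘ.*-cong (ℚ.toℚᵘ-fromℚᵘ (fromℕᵘ m)) (ℚ.toℚᵘ-fromℚᵘ (fromℕᵘ n)) ⟨
  toℚᵘ (fromℕ m) ℚᵘ.* toℚᵘ (fromℕ n)  ≃⟨ ℚ.toℚᵘ-homo-* (fromℕ m) (fromℕ n) ⟨
  toℚᵘ (fromℕ m * fromℕ n)              ∎)
  where open ℚᵘ.≤-Reasoning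

fromℕ-recip : ∀ n .⦃ _ : NonZero n ⦄ → fromℕ n * recip n ≡ 1ℚ
fromℕ-recip n@(suc k) = ℚ.toℚᵘ-injective (begin-equality
  toℚᵘ (fromℕ n * recip n)              ≃⟨ ℚ.toℚᵘ-homo-* (fromℕ n) (recip n) ⟩
  toℚᵘ (fromℕ n) ℚᵘ.* toℚᵘ (recip n)
    ≃⟨ ℚᵘ.*-cong (ℚ.toℚᵘ-fromℚᵘ (fromℕᵘ n)) (ℚ.toℚᵘ-fromℚᵘ (ℚᵘ.mkℚᵘ 1ℤ k)) ⟩
  fromℕᵘ n ℚᵘ.* ℚᵘ.mkℚᵘ 1ℤ k              ≃⟨ ℚᵘ.*≡* (ℤ-eq (+ n)) ⟩
  toℚᵘ 1ℚ                               ∎)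
  where
  open ℚᵘ.≤-Reasoning
  ℤ-eq : ∀ i → (i ℤ.* 1ℤ) ℤ.* 1ℤ ≡ 1ℤ ℤ.* (1ℤ ℤ.* i)
  ℤ-eq = ℤ-Solver.solve-∀

fromℕ-cancel : ∀ n .⦃ _ : NonZero n ⦄ {x y} → fromℕ n * x ≡ fromℕ n * y → x ≡ y
fromℕ-cancel n {x} {y} e = trans (undo x) (trans (cong (recip n *_) e) (sym (undo y)))
  where
  open ≡-Reasoning
  undo : ∀ z → z ≡ recip n * (fromℕ n * z)
  undo z = begin
    z                          ≡⟨ ℚ.*-identityˡ z ⟨
    1ℚ * z                     ≡⟨ cong (_* z) (fromℕ-recip n) ⟨
    fromℕ n * recip n * z
      ≡⟨ solve 3 (λ a b c → a :* b :* c := b :* (a :* c)) refl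
           (fromℕ n) (recip n) z ⟩
    recip n * (fromℕ n * z)    ∎

recip-* : ∀ m n .⦃ m≢0 : NonZero m ⦄ .⦃ n≢0 : NonZero n ⦄ →
          recip (m ℕ.* n) ⦃ ℕ.m*n≢0 m n ⦄ ≡ recip m * recip n
recip-* m n = fromℕ-cancel (m ℕ.* n) ⦃ m*n≢0 ⦄ (begin
  fromℕ (m ℕ.* n) * recip (m ℕ.* n) ⦃ m*n≢0 ⦄  ≡⟨ fromℕ-recip (m ℕ.* n) ⦃ m*n≢0 ⦄ ⟩
  1ℚ * 1ℚ                                      ≡⟨ cong₂ _*_ (fromℕ-recip m) (fromℕ-recip n) ⟨
  fromℕ m * recip m * (fromℕ n * recip n)
    ≡⟨ solve 4 (λ a b c d → a :* b :* (c :* d) := a :* c :* (b :* d)) refl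
         (fromℕ m) (recip m) (fromℕ n) (recip n) ⟩
  fromℕ m * fromℕ n * (recip m * recip n)      ≡⟨ cong (_* (recip m * recip n)) (fromℕ-* m n) ⟨
  fromℕ (m ℕ.* n) * (recip m * recip n)        ∎)
  where
  open ≡-Reasoning
  m*n≢0 = ℕ.m*n≢0 m n

^ℚ-+ : ∀ x m n → x ^ℚ (m ℕ.+ n) ≡ x ^ℚ m * x ^ℚ n
^ℚ-+ x zero    n = sym (ℚ.*-identityˡ (x ^ℚ n))
^ℚ-+ x (suc m) n = trans (cong (x *_) (^ℚ-+ x m n)) (sym (ℚ.*-assoc x (x ^ℚ m) (x ^ℚ n)))

^ℚ-* : ∀ x m n → x ^ℚ (n ℕ.* m) ≡ (x ^ℚ m) ^ℚ n
^ℚ-* x m zero    = refl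
^ℚ-* x m (suc n) = trans (^ℚ-+ x m (n ℕ.* m)) (cong (x ^ℚ m *_) (^ℚ-* x m n))

*-^ℚ : ∀ x y n → (x * y) ^ℚ n ≡ x ^ℚ n * y ^ℚ n
*-^ℚ x y zero    = refl
*-^ℚ x y (suc n) = trans (cong (x * y *_) (*-^ℚ x y n))
  (solve 4 (λ a b c d → a :* b :* (c :* d) := a :* c :* (b :* d)) refl x y (x ^ℚ n) (y ^ℚ n))

recip-^ : ∀ m n .⦃ _ : NonZero m ⦄ → recip (m ℕ.^ n) ⦃ ℕ.m^n≢0 m n ⦄ ≡ recip m ^ℚ n
recip-^ m zero    = refl
recip-^ m (suc n) = trans (recip-* m (m ℕ.^ n) ⦃ n≢0 = ℕ.m^n≢0 m n ⦄)
                          (cong (recip m *_) (recip-^ m n))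

-- Formal power series and the equation θ f = b f

-- Power series are their coefficient sequences ℕ → ℚ; shift 1 is
-- multiplication by the variable x and θ is the operator x d/dx.
shift : ℕ → (ℕ → ℚ) → ℕ → ℚ
shift zero    f q       = f q
shift (suc j) f zero    = 0ℚ
shift (suc j) f (suc q) = shift j f q

θ : (ℕ → ℚ) → ℕ → ℚ
θ f q = fromℕ q * f q

-- The coefficients of (b₀ x + b₁ x² + b₂ x³ + …) f.
conv : (ℕ → ℚ) → (ℕ → ℚ) → ℕ → ℚ
conv b f zero    = 0ℚ
conv b f (suc q) = b 0 * f q + conv (b ∘ suc) f q

shift-≤ : ∀ {j q} f → j ℕ.≤ q → shift j f q ≡ f (q ∸ j)
shift-≤ f z≤n     = refl
shift-≤ f (s≤s h) = shift-≤ f h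

shift-> : ∀ {j q} f → q ℕ.< j → shift j f q ≡ 0ℚ
shift-> {q = zero}  f (s≤s h) = refl
shift-> {q = suc q} f (s≤s h) = shift-> f h

shift-+ : ∀ i j f q → shift i (shift j f) q ≡ shift (i ℕ.+ j) f q
shift-+ zero    j f q       = refl
shift-+ (suc i) j f zero    = refl
shift-+ (suc i) j f (suc q) = shift-+ i j f q

conv-congˡ : ∀ {b c} f q → (∀ k → k ℕ.< q → b k ≡ c k) → conv b f q ≡ conv c f q
conv-congˡ f zero    e = refl
conv-congˡ f (suc q) e = cong₂ _+_ (cong (_* f q) (e 0 (s≤s z≤n)))
  (conv-congˡ f q (λ k k<q → e (suc k) (s≤s k<q)))

-- The left factor has no constant term, so coefficient `q` of the product sees only earlier
-- coefficients of `f`. This makes θ f = b f a recursion.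
conv-congʳ : ∀ b {f g} q → (∀ k → k ℕ.< q → f k ≡ g k) → conv b f q ≡ conv b g q
conv-congʳ b zero    e = refl
conv-congʳ b (suc q) e = cong₂ _+_ (cong (b 0 *_) (e q ℕ.≤-refl))
  (conv-congʳ (b ∘ suc) q (λ k k<q → e k (ℕ.m<n⇒m<1+n k<q)))

conv-+ˡ : ∀ b c f q → conv (λ k → b k + c k) f q ≡ conv b f q + conv c f q
conv-+ˡ b c f zero    = refl
conv-+ˡ b c f (suc q) =
  trans (cong (λ s → (b 0 + c 0) * f q + s) (conv-+ˡ (b ∘ suc) (c ∘ suc) f q))
    (solve 5 (λ b c f s t → (b :+ c) :* f :+ (s :+ t) := b :* f :+ s :+ (c :* f :+ t)) refl
      (b 0) (c 0) (f q) (conv (b ∘ suc) f q) (conv (c ∘ suc) f q))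

conv-*ˡ : ∀ r b f q → conv (λ k → r * b k) f q ≡ r * conv b f q
conv-*ˡ r b f zero    = sym (ℚ.*-zeroʳ r)
conv-*ˡ r b f (suc q) = trans (cong (λ s → r * b 0 * f q + s) (conv-*ˡ r (b ∘ suc) f q))
  (solve 4 (λ r b f s → r :* b :* f :+ r :* s := r :* (b :* f :+ s)) refl
    r (b 0) (f q) (conv (b ∘ suc) f q))

conv-+ʳ : ∀ b f g q → conv b (λ k → f k + g k) q ≡ conv b f q + conv b g q
conv-+ʳ b f g zero    = refl
conv-+ʳ b f g (suc q) =
  trans (cong (λ s → b 0 * (f q + g q) + s) (conv-+ʳ (b ∘ suc) f g q))
    (solve 5 (λ b f g s t → b :* (f :+ g) :+ (s :+ t) := b :* f :+ s :+ (b :* g :+ t)) refl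
      (b 0) (f q) (g q) (conv (b ∘ suc) f q) (conv (b ∘ suc) g q))

conv-*ʳ : ∀ r b f q → conv b (λ k → r * f k) q ≡ r * conv b f q
conv-*ʳ r b f zero    = sym (ℚ.*-zeroʳ r)
conv-*ʳ r b f (suc q) = trans (cong (λ s → b 0 * (r * f q) + s) (conv-*ʳ r (b ∘ suc) f q))
  (solve 4 (λ r b f s → b :* (r :* f) :+ r :* s := r :* (b :* f :+ s)) refl
    r (b 0) (f q) (conv (b ∘ suc) f q))

conv-0ˡ : ∀ f q → conv (λ _ → 0ℚ) f q ≡ 0ℚ
conv-0ˡ f zero    = refl
conv-0ˡ f (suc q) = trans (cong₂ _+_ (ℚ.*-zeroˡ (f q)) (conv-0ˡ f q)) (ℚ.+-identityʳ 0ℚ)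

conv-0ʳ : ∀ b q → conv b (λ _ → 0ℚ) q ≡ 0ℚ
conv-0ʳ b zero    = refl
conv-0ʳ b (suc q) = trans (cong₂ _+_ (ℚ.*-zeroʳ (b 0)) (conv-0ʳ (b ∘ suc) q)) (ℚ.+-identityʳ 0ℚ)

conv-shift₁ : ∀ b f q → conv b (shift 1 f) q ≡ shift 1 (conv b f) q
conv-shift₁ b f zero          = refl
conv-shift₁ b f (suc zero)    = trans (ℚ.+-identityʳ _) (ℚ.*-zeroʳ (b 0))
conv-shift₁ b f (suc (suc q)) = cong (λ s → b 0 * f q + s) (conv-shift₁ (b ∘ suc) f (suc q))

conv-shift : ∀ j b f q → conv b (shift j f) q ≡ shift j (conv b f) q
conv-shift zero    b f q = refl
conv-shift (suc j) b f q = trans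
  (conv-congʳ b q (λ k _ → sym (shift-+ 1 j f k)))
  (trans (conv-shift₁ b (shift j f) q) (step q))
  where
  step : ∀ q → shift 1 (conv b (shift j f)) q ≡ shift (suc j) (conv b f) q
  step zero    = refl
  step (suc q) = conv-shift j b f q

-- The product rule for x^j f, with θ x^j = j x^j.
θ-shift : ∀ j f q → θ (shift j f) q ≡ shift j (θ f) q + fromℕ j * shift j f q
θ-shift zero    f q    = sym (trans (cong (λ s → θ f q + s) (ℚ.*-zeroˡ (f q)))
                               (ℚ.+-identityʳ (θ f q)))
θ-shift (suc j) f zero = sym (trans (ℚ.+-identityˡ _)
  (trans (ℚ.*-zeroʳ (fromℕ (suc j))) (sym (ℚ.*-zeroʳ (fromℕ 0)))))
θ-shift (suc j) f (suc q) = begin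
  fromℕ (suc q) * s                 ≡⟨ cong (_* s) (fromℕ-+ 1 q) ⟩
  (1ℚ + fromℕ q) * s
    ≡⟨ solve 2 (λ a s → (con 1ℚ :+ a) :* s := a :* s :+ s) refl
         (fromℕ q) s ⟩
  θ (shift j f) q + s               ≡⟨ cong (_+ s) (θ-shift j f q) ⟩
  t + fromℕ j * s + s
    ≡⟨ solve 3 (λ t a s → t :+ a :* s :+ s := t :+ (con 1ℚ :+ a) :* s) refl
         t (fromℕ j) s ⟩
  t + (1ℚ + fromℕ j) * s            ≡⟨ cong (λ c → t + c * s) (fromℕ-+ 1 j) ⟨
  t + fromℕ (suc j) * s             ∎
  where
  open ≡-Reasoning
  s = shift j f q
  t = shift j (θ f) q

-- For q > 0 the equation gives q f(q) in terms of earlier coefficients, and q can be cancelled. The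
-- bound `n` is there because a truncated exponential solves the full equation only up to some
-- degree.
θ-unique : ∀ b f g n → f 0 ≡ g 0 →
           (∀ q → q ℕ.≤ n → θ f q ≡ conv b f q) → (∀ q → q ℕ.≤ n → θ g q ≡ conv b g q) →
           ∀ q → q ℕ.≤ n → f q ≡ g q
θ-unique b f g n e hf hg = <-rec (λ q → q ℕ.≤ n → f q ≡ g q) step
  where
  step : ∀ q → (∀ {k} → k ℕ.< q → k ℕ.≤ n → f k ≡ g k) → q ℕ.≤ n → f q ≡ g q
  step zero    _  _   = e
  step (suc q) ih q≤n = fromℕ-cancel (suc q) (trans (hf (suc q) q≤n)
    (trans (conv-congʳ b (suc q) (λ k k<q → ih k<q (ℕ.≤-trans (ℕ.<⇒≤ k<q) q≤n)))
      (sym (hg (suc q) q≤n))))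

-- Newton's identities

-- The coefficient of x^(k+1), not of x^k, in θ E / E: `conv` starts its left factor at x.
newton : List ℕ → ℕ → ℚ
newton ls k = (- 1ℚ) ^ℚ k * powerSum (suc k) ls

-- A new entry l multiplies E by 1 + l x, so the product rule adds l x / (1 + l x) to θ E / E.
-- Expanded as a geometric series, this is the contribution of l to the signed power sums.
θ-elementary : ∀ ls q → θ (λ q → fromℕ (elementary q ls)) q ≡
                        conv (newton ls) (λ q → fromℕ (elementary q ls)) q
θ-elementary []       zero    = ℚ.*-zeroˡ 1ℚ
θ-elementary []       (suc q) = trans (ℚ.*-zeroʳ (fromℕ (suc q)))
  (sym (trans (conv-congˡ E (suc q) (λ k _ → ℚ.*-zeroʳ ((- 1ℚ) ^ℚ k)))
              (conv-0ˡ E (suc q))))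
  where E = λ q → fromℕ (elementary q [])
θ-elementary (l ∷ ls) q = begin
  fromℕ q * E′ q
    ≡⟨ cong (fromℕ q *_) (E′-eq q) ⟩
  fromℕ q * (E q + x * xE q)
    ≡⟨ solve 4 (λ q e x s → q :* (e :+ x :* s) := q :* e :+ x :* (q :* s)) refl
         (fromℕ q) (E q) x (xE q) ⟩
  θ E q + x * θ xE q
    ≡⟨ cong₂ (λ s t → s + x * t) (θ-elementary ls q) (θ-shift 1 E q) ⟩
  conv b E q + x * (shift 1 (θ E) q + 1ℚ * xE q)
    ≡⟨ cong (λ s → conv b E q + x * (s + 1ℚ * xE q)) (shift₁-cong (θ-elementary ls) q) ⟩
  conv b E q + x * (shift 1 (conv b E) q + 1ℚ * xE q)
    ≡⟨ solve 4 (λ c x s t → c :+ x :* (s :+ con 1ℚ :* t) := x :* t :+ (c :+ x :* s)) refl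
         (conv b E q) x (shift 1 (conv b E) q) (xE q) ⟩
  x * xE q + (conv b E q + x * shift 1 (conv b E) q)
    ≡⟨ cong₂ _+_ (conv-geometric q) (expand b q) ⟨
  conv g E′ q + conv b E′ q
    ≡⟨ conv-+ˡ g b E′ q ⟨
  conv (λ k → g k + b k) E′ q
    ≡⟨ conv-congˡ E′ q (λ k _ → ℚ.*-distribˡ-+ ((- 1ℚ) ^ℚ k) (x ^ℚ suc k) (powerSum (suc k) ls)) ⟨
  conv (newton (l ∷ ls)) E′ q ∎
  where
  open ≡-Reasoning
  x = fromℕ l
  b = newton ls
  g = λ k → (- 1ℚ) ^ℚ k * x ^ℚ suc k
  E E′ xE : ℕ → ℚ
  E q  = fromℕ (elementary q ls)
  E′ q = fromℕ (elementary q (l ∷ ls))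
  xE   = shift 1 E

  shift₁-cong : ∀ {f h} → (∀ q → f q ≡ h q) → ∀ q → shift 1 f q ≡ shift 1 h q
  shift₁-cong e zero    = refl
  shift₁-cong e (suc q) = e q

  E′-eq : ∀ q → E′ q ≡ E q + x * xE q
  E′-eq zero    = sym (trans (cong (λ s → E 0 + s) (ℚ.*-zeroʳ x)) (ℚ.+-identityʳ (E 0)))
  E′-eq (suc q) = trans (fromℕ-+ (l ℕ.* elementary q ls) _)
    (trans (cong (_+ E (suc q)) (fromℕ-* l (elementary q ls)))
           (ℚ.+-comm (x * E q) (E (suc q))))

  expand : ∀ c q → conv c E′ q ≡ conv c E q + x * shift 1 (conv c E) q
  expand c q = begin
    conv c E′ q                              ≡⟨ conv-congʳ c q (λ k _ → E′-eq k) ⟩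
    conv c (λ k → E k + x * xE k) q          ≡⟨ conv-+ʳ c E (λ k → x * xE k) q ⟩
    conv c E q + conv c (λ k → x * xE k) q
      ≡⟨ cong (λ s → conv c E q + s)
           (trans (conv-*ʳ x c xE q) (cong (x *_) (conv-shift 1 c E q))) ⟩
    conv c E q + x * shift 1 (conv c E) q    ∎

  g-suc : ∀ k → g (suc k) ≡ - x * g k
  g-suc k = solve 3 (λ s x y → (:- con 1ℚ :* s) :* (x :* (x :* y)) := :- x :* (s :* (x :* y))) refl
    ((- 1ℚ) ^ℚ k) x (x ^ℚ k)

  -- Σₖ (-1)ᵏ lᵏ⁺¹ xᵏ⁺¹ = l x / (1 + l x).
  conv-geometric : ∀ q → conv g E′ q ≡ x * xE q
  conv-geometric q = trans (expand g q) (telescope q)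
    where
    telescope : ∀ q → conv g E q + x * shift 1 (conv g E) q ≡ x * xE q
    telescope zero    = ℚ.+-identityˡ _
    -- The geometric series G satisfies G = l x - l x G; the second term cancels against the factor
    -- 1 + l x.
    telescope (suc q) = begin
      g 0 * E q + conv (g ∘ suc) E q + x * c
        ≡⟨ cong (λ s → g 0 * E q + s + x * c)
             (trans (conv-congˡ E q (λ k _ → g-suc k)) (conv-*ˡ (- x) g E q)) ⟩
      g 0 * E q + (- x) * c + x * c
        ≡⟨ solve 3 (λ x e c → (con 1ℚ :* (x :* con 1ℚ)) :* e :+ (:- x) :* c :+ x :* c := x :* e) refl
             x (E q) c ⟩
      x * E q ∎
      where c = conv g E q

-- Multiplication by the exponential of a monomial

sumTo : ℕ → (ℕ → ℚ) → ℚ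
sumTo n g = sumℚ (applyUpTo g n)

sumTo-cong : ∀ n {g h} → (∀ i → g i ≡ h i) → sumTo n g ≡ sumTo n h
sumTo-cong zero    e = refl
sumTo-cong (suc n) e = cong₂ _+_ (e 0) (sumTo-cong n (e ∘ suc))

sumTo-+ : ∀ n g h → sumTo n (λ i → g i + h i) ≡ sumTo n g + sumTo n h
sumTo-+ zero    g h = refl
sumTo-+ (suc n) g h = trans (cong (λ s → g 0 + h 0 + s) (sumTo-+ n (g ∘ suc) (h ∘ suc)))
  (solve 4 (λ a b c d → a :+ b :+ (c :+ d) := a :+ c :+ (b :+ d)) refl
    (g 0) (h 0) (sumTo n (g ∘ suc)) (sumTo n (h ∘ suc)))

sumTo-* : ∀ n c g → sumTo n (λ i → c * g i) ≡ c * sumTo n g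
sumTo-* zero    c g = sym (ℚ.*-zeroʳ c)
sumTo-* (suc n) c g = trans (cong (λ s → c * g 0 + s) (sumTo-* n c (g ∘ suc)))
  (sym (ℚ.*-distribˡ-+ c (g 0) (sumTo n (g ∘ suc))))

sumTo-extend : ∀ {m n} g → m ℕ.≤ n → (∀ i → m ℕ.≤ i → g i ≡ 0ℚ) → sumTo n g ≡ sumTo m g
sumTo-extend {n = zero}  g z≤n     e = refl
sumTo-extend {n = suc n} g z≤n     e = trans
  (cong₂ _+_ (e 0 z≤n) (sumTo-extend {n = n} (g ∘ suc) z≤n (λ i _ → e (suc i) z≤n))) refl
sumTo-extend             g (s≤s h) e =
  cong (λ s → g 0 + s) (sumTo-extend (g ∘ suc) h (λ i m≤i → e (suc i) (s≤s m≤i)))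

conv-sumTo : ∀ n (c : ℕ → ℚ) (g : ℕ → ℕ → ℚ) b q → conv b (λ r → sumTo n (λ i → c i * g i r)) q ≡
                           sumTo n (λ i → c i * conv b (g i) q)
conv-sumTo zero    c g b q = conv-0ʳ b q
conv-sumTo (suc n) c g b q = trans
  (conv-+ʳ b (λ r → c 0 * g 0 r) (λ r → sumTo n (λ i → c (suc i) * g (suc i) r)) q)
  (cong₂ _+_ (conv-*ʳ (c 0) b (g 0) q) (conv-sumTo n (c ∘ suc) (g ∘ suc) b q))

shift-sumTo : ∀ n (c : ℕ → ℚ) (g : ℕ → ℕ → ℚ) j q → shift j (λ r → sumTo n (λ i → c i * g i r)) q ≡
                            sumTo n (λ i → c i * shift j (g i) q)
shift-sumTo n c g zero    q       = refl
shift-sumTo n c g (suc j) (suc q) = shift-sumTo n c g j q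
shift-sumTo n c g (suc j) zero    =
  sym (sumTo-extend {n = n} (λ i → c i * 0ℚ) z≤n (λ i _ → ℚ.*-zeroʳ (c i)))

expCoeff : ℚ → ℕ → ℚ
expCoeff a n = a ^ℚ n * recip (n !) ⦃ n ℕ.!≢0 ⦄

-- The derivative of exp (a y) is a exp (a y), read off coefficientwise.
expCoeff-suc : ∀ a n → fromℕ (suc n) * expCoeff a (suc n) ≡ a * expCoeff a n
expCoeff-suc a n = begin
  s * (a * a ^ℚ n * recip (suc n !) ⦃ suc n ℕ.!≢0 ⦄)
    ≡⟨ cong (λ t → s * (a * a ^ℚ n * t)) (recip-* (suc n) (n !) ⦃ n≢0 = n ℕ.!≢0 ⦄) ⟩
  s * (a * a ^ℚ n * (recip (suc n) * r))
    ≡⟨ solve 5 (λ s a p t r → s :* (a :* p :* (t :* r)) := (s :* t) :* (a :* (p :* r))) refl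
         s a (a ^ℚ n) (recip (suc n)) r ⟩
  s * recip (suc n) * (a * (a ^ℚ n * r))
    ≡⟨ cong (_* (a * (a ^ℚ n * r))) (fromℕ-recip (suc n)) ⟩
  1ℚ * (a * (a ^ℚ n * r))
    ≡⟨ ℚ.*-identityˡ _ ⟩
  a * expCoeff a n ∎
  where
  open ≡-Reasoning
  s = fromℕ (suc n)
  r = recip (n !) ⦃ n ℕ.!≢0 ⦄

-- The first n terms of exp (a xʲ) f.
expTo : ℕ → ℚ → ℕ → (ℕ → ℚ) → ℕ → ℚ
expTo n a j f q = sumTo n (λ i → expCoeff a i * shift (i ℕ.* j) f q)

-- The product rule: θ acts on `f`, giving `conv b`, or on the exponential, giving the factor j a
-- x^j. Differentiation lowers the index of a term, hence one term fewer in the last summand.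
θ-expTo : ∀ n a j f b → (∀ q → θ f q ≡ conv b f q) → ∀ q →
          θ (expTo (suc n) a j f) q ≡
          conv b (expTo (suc n) a j f) q + fromℕ j * a * shift j (expTo n a j f) q
θ-expTo n a j f b θf q = begin
  fromℕ q * expTo (suc n) a j f q
    ≡⟨ sumTo-* (suc n) (fromℕ q) (λ i → D i * sh i q) ⟨
  sumTo (suc n) (λ i → fromℕ q * (D i * sh i q))
    ≡⟨ sumTo-cong (suc n) term ⟩
  sumTo (suc n) (λ i → D i * conv b (sh i) q + fromℕ (i ℕ.* j) * D i * sh i q)
    ≡⟨ sumTo-+ (suc n) (λ i → D i * conv b (sh i) q) (λ i → fromℕ (i ℕ.* j) * D i * sh i q) ⟩
  sumTo (suc n) (λ i → D i * conv b (sh i) q) +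
  (0ℚ * D 0 * sh 0 q + sumTo n (λ i → fromℕ (suc i ℕ.* j) * D (suc i) * sh (suc i) q))
    -- The constant term of the exponential has derivative zero; the remaining terms are reindexed
    -- from i + 1 to i.
    ≡⟨ cong₂ _+_ (sym (conv-sumTo (suc n) D sh b q)) (begin
         0ℚ * D 0 * sh 0 q + sumTo n (λ i → fromℕ (suc i ℕ.* j) * D (suc i) * sh (suc i) q)
           ≡⟨ cong₂ _+_ (trans (cong (_* sh 0 q) (ℚ.*-zeroˡ (D 0))) (ℚ.*-zeroˡ (sh 0 q)))
                       (sumTo-cong n term′) ⟩
         0ℚ + sumTo n (λ i → fromℕ j * a * (D i * shift j (sh i) q))
           ≡⟨ ℚ.+-identityˡ _ ⟩
         sumTo n (λ i → fromℕ j * a * (D i * shift j (sh i) q))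
           ≡⟨ sumTo-* n (fromℕ j * a) (λ i → D i * shift j (sh i) q) ⟩
         fromℕ j * a * sumTo n (λ i → D i * shift j (sh i) q)
           ≡⟨ cong (fromℕ j * a *_) (shift-sumTo n D sh j q) ⟨
         fromℕ j * a * shift j (expTo n a j f) q ∎) ⟩
  conv b (expTo (suc n) a j f) q + fromℕ j * a * shift j (expTo n a j f) q ∎
  where
  open ≡-Reasoning
  D = expCoeff a
  sh : ℕ → ℕ → ℚ
  sh i = shift (i ℕ.* j) f

  shift-cong : ∀ i q → shift i (θ f) q ≡ shift i (conv b f) q
  shift-cong zero    q       = θf q
  shift-cong (suc i) zero    = refl
  shift-cong (suc i) (suc q) = shift-cong i q

  term : ∀ i → fromℕ q * (D i * sh i q) ≡ D i * conv b (sh i) q + fromℕ (i ℕ.* j) * D i * sh i q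
  term i = begin
    fromℕ q * (D i * sh i q)
      ≡⟨ solve 3 (λ q d s → q :* (d :* s) := d :* (q :* s)) refl (fromℕ q) (D i) (sh i q) ⟩
    D i * θ (sh i) q
      ≡⟨ cong (D i *_) (θ-shift (i ℕ.* j) f q) ⟩
    D i * (shift (i ℕ.* j) (θ f) q + fromℕ (i ℕ.* j) * sh i q)
      ≡⟨ cong (λ s → D i * (s + fromℕ (i ℕ.* j) * sh i q))
           (trans (shift-cong (i ℕ.* j) q) (sym (conv-shift (i ℕ.* j) b f q))) ⟩
    D i * (conv b (sh i) q + fromℕ (i ℕ.* j) * sh i q)
      ≡⟨ solve 4 (λ d c n s → d :* (c :+ n :* s) := d :* c :+ n :* d :* s) refl
           (D i) (conv b (sh i) q) (fromℕ (i ℕ.* j)) (sh i q) ⟩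
    D i * conv b (sh i) q + fromℕ (i ℕ.* j) * D i * sh i q ∎

  term′ : ∀ i → fromℕ (suc i ℕ.* j) * D (suc i) * sh (suc i) q ≡
                fromℕ j * a * (D i * shift j (sh i) q)
  term′ i = begin
    fromℕ (suc i ℕ.* j) * D (suc i) * sh (suc i) q
      ≡⟨ cong₂ (λ s t → s * D (suc i) * t) (fromℕ-* (suc i) j) (sym (shift-+ j (i ℕ.* j) f q)) ⟩
    fromℕ (suc i) * fromℕ j * D (suc i) * shift j (sh i) q
      ≡⟨ solve 4 (λ n j d s → n :* j :* d :* s := n :* d :* (j :* s)) refl
           (fromℕ (suc i)) (fromℕ j) (D (suc i)) (shift j (sh i) q) ⟩
    fromℕ (suc i) * D (suc i) * (fromℕ j * shift j (sh i) q)
      ≡⟨ cong (_* (fromℕ j * shift j (sh i) q)) (expCoeff-suc a i) ⟩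
    a * D i * (fromℕ j * shift j (sh i) q)
      ≡⟨ solve 4 (λ a d j s → a :* d :* (j :* s) := j :* a :* (d :* s)) refl
           a (D i) (fromℕ j) (shift j (sh i) q) ⟩
    fromℕ j * a * (D i * shift j (sh i) q) ∎

δ : ℕ → ℕ → ℚ
δ zero    zero    = 1ℚ
δ zero    (suc k) = 0ℚ
δ (suc m) zero    = 0ℚ
δ (suc m) (suc k) = δ m k

-- In the indexing of `conv`, `δ m` is the monomial x^(m+1).
conv-δ : ∀ m f q → conv (δ m) f q ≡ shift (suc m) f q
conv-δ m       f zero    = refl
conv-δ zero    f (suc q) = trans (cong₂ _+_ (ℚ.*-identityˡ (f q)) (conv-0ˡ f q))
                               (ℚ.+-identityʳ (f q))
conv-δ (suc m) f (suc q) = trans (cong₂ _+_ (ℚ.*-zeroˡ (f q)) (conv-δ m f q)) (ℚ.+-identityˡ _)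

truncate : ℕ → (ℕ → ℚ) → ℕ → ℚ
truncate zero    b k       = 0ℚ
truncate (suc m) b zero    = b 0
truncate (suc m) b (suc k) = truncate m (b ∘ suc) k

truncate-< : ∀ {m k} b → k ℕ.< m → truncate m b k ≡ b k
truncate-< {suc m} {zero}  b h       = refl
truncate-< {suc m} {suc k} b (s≤s h) = truncate-< (b ∘ suc) h

truncate-suc : ∀ m b k → truncate (suc m) b k ≡ truncate m b k + b m * δ m k
truncate-suc zero    b zero    = sym (trans (ℚ.+-identityˡ _) (ℚ.*-identityʳ (b 0)))
truncate-suc zero    b (suc k) = sym (trans (ℚ.+-identityˡ _) (ℚ.*-zeroʳ (b 0)))
truncate-suc (suc m) b zero    = sym (trans (cong (λ s → b 0 + s) (ℚ.*-zeroʳ (b (suc m))))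
                                       (ℚ.+-identityʳ (b 0)))
truncate-suc (suc m) b (suc k) = truncate-suc m (b ∘ suc) k

-- Multiplication by the full exp (a x^j) for positive j: term i starts at degree i j, so q + 1
-- terms already give the coefficient of x^q.
expMul : ℚ → ℕ → (ℕ → ℚ) → ℕ → ℚ
expMul a j f q = expTo (suc q) a j f q

expTo≡expMul : ∀ a m f n q → q ℕ.< n → expTo n a (suc m) f q ≡ expMul a (suc m) f q
expTo≡expMul a m f n q q<n = sumTo-extend _ q<n λ i q<i →
  trans (cong (expCoeff a i *_) (shift-> f (ℕ.<-≤-trans q<i (ℕ.m≤m*n i (suc m)))))
        (ℚ.*-zeroʳ (expCoeff a i))

θ-expMul : ∀ a m f b → (∀ q → θ f q ≡ conv b f q) → ∀ q →
           θ (expMul a (suc m) f) q ≡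
           conv (λ k → b k + fromℕ (suc m) * a * δ m k) (expMul a (suc m) f) q
θ-expMul a m f b θf q = begin
  θ F q
    ≡⟨ θ-expTo q a (suc m) f b θf q ⟩
  conv b (expTo (suc q) a (suc m) f) q + c * shift (suc m) (expTo q a (suc m) f) q
    ≡⟨ cong (λ s → conv b (expTo (suc q) a (suc m) f) q + c * s)
         (conv-δ m (expTo q a (suc m) f) q) ⟨
  conv b (expTo (suc q) a (suc m) f) q + c * conv (δ m) (expTo q a (suc m) f) q
    -- Only coefficients below q enter, and for these q terms of the exponential are as good as all.
    ≡⟨ cong₂ (λ s t → s + c * t)
         (conv-congʳ b q (λ k k<q → expTo≡expMul a m f (suc q) k (ℕ.m<n⇒m<1+n k<q)))
         (conv-congʳ (δ m) q (λ k k<q → expTo≡expMul a m f q k k<q)) ⟩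
  conv b F q + c * conv (δ m) F q
    ≡⟨ cong (λ s → conv b F q + s) (conv-*ˡ c (δ m) F q) ⟨
  conv b F q + conv (λ k → c * δ m k) F q
    ≡⟨ conv-+ˡ b (λ k → c * δ m k) F q ⟨
  conv (λ k → b k + c * δ m k) F q ∎
  where
  open ≡-Reasoning
  F = expMul a (suc m) f
  c = fromℕ (suc m) * a

-- Sums over partitions

module _ {A : Set} (v : A → ℚ) where

  sumℚ-++ : ∀ xs ys → sumℚ (map v (xs ++ ys)) ≡ sumℚ (map v xs) + sumℚ (map v ys)
  sumℚ-++ []       ys = sym (ℚ.+-identityˡ _)
  sumℚ-++ (x ∷ xs) ys = trans (cong (λ s → v x + s) (sumℚ-++ xs ys))
    (sym (ℚ.+-assoc (v x) (sumℚ (map v xs)) (sumℚ (map v ys))))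

  sumℚ-concatMap : ∀ {B : Set} (h : B → List A) ns →
    sumℚ (map v (concatMap h ns)) ≡ sumℚ (map (λ n → sumℚ (map v (h n))) ns)
  sumℚ-concatMap h []       = refl
  sumℚ-concatMap h (n ∷ ns) = trans (sumℚ-++ (h n) (concatMap h ns))
    (cong (λ s → sumℚ (map v (h n)) + s) (sumℚ-concatMap h ns))

  sumℚ-* : ∀ c xs → sumℚ (map (λ x → c * v x) xs) ≡ c * sumℚ (map v xs)
  sumℚ-* c []       = sym (ℚ.*-zeroʳ c)
  sumℚ-* c (x ∷ xs) = trans (cong (λ s → c * v x + s) (sumℚ-* c xs))
    (sym (ℚ.*-distribˡ-+ c (v x) (sumℚ (map v xs))))

-- a m is the coefficient of xᵐ⁺¹ in the series whose θ-image is Σₖ bₖ xᵏ⁺¹, so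
-- that Σ_q partitionSum m q x^q = exp (a₀ x + … + aₘ₋₁ xᵐ).
module PartitionSum (b : ℕ → ℚ) where

  a : ℕ → ℚ
  a m = b m * recip (suc m)

  blockValue : Block → ℚ
  blockValue β = expCoeff (a (pred (part β))) (mult β)

  value : List Block → ℚ
  value p = productℚ (map blockValue p)

  partitionSum : ℕ → ℕ → ℚ
  partitionSum m q = sumℚ (map value (partitions≤ m q))

  -- A block of multiplicity n+1 is the term of index n+1 of the exponential. If its weight exceeds
  -- q, there are no partitions and the shift reaches past the coefficient, so both sides vanish.
  sum-withBlock : ∀ m q n → sumℚ (map value (withBlock m q n)) ≡
                  expCoeff (a m) (suc n) * shift (suc n ℕ.* suc m) (partitionSum m) q
  sum-withBlock m q n with suc n ℕ.* suc m ℕ.≤? q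
  ... | yes le = begin
    sumℚ (map value (map ((suc m ^^ suc n) ∷_) ps))
      ≡⟨ cong sumℚ (map-∘ ps) ⟨
    sumℚ (map (λ p → D * value p) ps)
      ≡⟨ sumℚ-* value D ps ⟩
    D * partitionSum m (q ∸ suc n ℕ.* suc m)
      ≡⟨ cong (D *_) (shift-≤ (partitionSum m) le) ⟨
    D * shift (suc n ℕ.* suc m) (partitionSum m) q ∎
    where
    open ≡-Reasoning
    D  = expCoeff (a m) (suc n)
    ps = partitions≤ m (q ∸ suc n ℕ.* suc m)
  ... | no  ≰  = sym (trans (cong (expCoeff (a m) (suc n) *_) (shift-> (partitionSum m) (ℕ.≰⇒> ≰)))
                            (ℚ.*-zeroʳ (expCoeff (a m) (suc n))))

  -- The partitions without the part m+1 form the term of index 0; `upTo q` supplies the indices 1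
  -- to q.
  partitionSum-suc : ∀ m q → partitionSum (suc m) q ≡ expMul (a m) (suc m) (partitionSum m) q
  partitionSum-suc m q = begin
    sumℚ (map value (partitions≤ m q ++ concatMap (withBlock m q) (upTo q)))
      ≡⟨ sumℚ-++ value (partitions≤ m q) (concatMap (withBlock m q) (upTo q)) ⟩
    partitionSum m q + sumℚ (map value (concatMap (withBlock m q) (upTo q)))
      ≡⟨ cong₂ _+_ (sym (ℚ.*-identityˡ (partitionSum m q)))
           (trans (sumℚ-concatMap value (withBlock m q) (upTo q))
             (trans (cong sumℚ (map-upTo (λ n → sumℚ (map value (withBlock m q n))) q))
               (sumTo-cong q (sum-withBlock m q)))) ⟩
    expMul (a m) (suc m) (partitionSum m) q ∎
    where open ≡-Reasoning

  partitionSum-0 : ∀ m → partitionSum m 0 ≡ 1ℚ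
  partitionSum-0 zero    = refl
  partitionSum-0 (suc m) =
    trans (cong (sumℚ ∘ map value) (++-identityʳ (partitions≤ m 0))) (partitionSum-0 m)

  -- The factor exp (aₘ x^(m+1)) adds (m+1) aₘ x^(m+1) to the right-hand side. The division by m+1
  -- in `a` makes this coefficient bₘ, the next one of the truncation.
  θ-partitionSum : ∀ m q → θ (partitionSum m) q ≡ conv (truncate m b) (partitionSum m) q
  θ-partitionSum zero    zero    = ℚ.*-zeroˡ 1ℚ
  θ-partitionSum zero    (suc q) =
    trans (ℚ.*-zeroʳ (fromℕ (suc q))) (sym (conv-0ˡ (partitionSum 0) (suc q)))
  θ-partitionSum (suc m) q = begin
    fromℕ q * partitionSum (suc m) q
      ≡⟨ cong (fromℕ q *_) (partitionSum-suc m q) ⟩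
    θ F q
      ≡⟨ θ-expMul (a m) m (partitionSum m) (truncate m b) (θ-partitionSum m) q ⟩
    conv (λ k → truncate m b k + fromℕ (suc m) * a m * δ m k) F q
      ≡⟨ conv-congˡ F q (λ k _ → trans (cong (λ s → truncate m b k + s * δ m k) scale)
                                       (sym (truncate-suc m b k))) ⟩
    conv (truncate (suc m) b) F q
      ≡⟨ conv-congʳ (truncate (suc m) b) q (λ k _ → sym (partitionSum-suc m k)) ⟩
    conv (truncate (suc m) b) (partitionSum (suc m)) q ∎
    where
    open ≡-Reasoning
    F = expMul (a m) (suc m) (partitionSum m)
    scale : fromℕ (suc m) * a m ≡ b m
    scale = begin
      fromℕ (suc m) * (b m * recip (suc m))
        ≡⟨ solve 3 (λ s b r → s :* (b :* r) := b :* (s :* r)) refl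
             (fromℕ (suc m)) (b m) (recip (suc m)) ⟩
      b m * (fromℕ (suc m) * recip (suc m))
        ≡⟨ cong (b m *_) (fromℕ-recip (suc m)) ⟩
      b m * 1ℚ
        ≡⟨ ℚ.*-identityʳ (b m) ⟩
      b m ∎

module _ (ls : List ℕ) where
  open PartitionSum (newton ls)

  -- Both series solve Newton's equation up to degree q, since the coefficients cut off at stage q
  -- start at x^(q+1).
  elementary≡partitionSum : ∀ q → fromℕ (elementary q ls) ≡ partitionSum q q
  elementary≡partitionSum q =
    θ-unique (newton ls) (λ r → fromℕ (elementary r ls)) (partitionSum q) q
      (sym (partitionSum-0 q))
      (λ r _ → θ-elementary ls r)
      (λ r r≤q → trans (θ-partitionSum q r)
        (conv-congˡ (partitionSum q) r (λ k k<r → truncate-< (newton ls) (ℕ.<-≤-trans k<r r≤q))))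
      q ℕ.≤-refl

  -- Signs and coefficients, block by block

  excess : Block → ℕ
  excess β = mult β ℕ.* pred (part β)

  factor : Block → ℚ
  factor β = coefficient β * powerSum (part β) ls ^ℚ mult β

  weight≡mult+excess : ∀ β → weight β ≡ mult β ℕ.+ excess β
  weight≡mult+excess β@(l ^^ n) =
    trans (cong (n ℕ.*_) (sym (ℕ.suc-pred l))) (ℕ.*-suc n (pred l))

  -- A block weighs n λ = n + n (λ - 1), so the truncated subtraction in the exponent loses nothing.
  weights∸mults : ∀ p → sum (map weight p) ∸ sum (map mult p) ≡ sum (map excess p)
  weights∸mults p = trans (cong (_∸ sum (map mult p)) (go p))
                          (ℕ.m+n∸m≡n (sum (map mult p)) (sum (map excess p)))
    where
    open ≡-Reasoning
    regroup : ∀ m e s t → m ℕ.+ e ℕ.+ (s ℕ.+ t) ≡ m ℕ.+ s ℕ.+ (e ℕ.+ t)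
    regroup = ℕ-Solver.solve-∀
    go : ∀ p → sum (map weight p) ≡ sum (map mult p) ℕ.+ sum (map excess p)
    go []      = refl
    go (β ∷ p) = trans (cong₂ ℕ._+_ (weight≡mult+excess β) (go p))
      (regroup (mult β) (excess β) (sum (map mult p)) (sum (map excess p)))

  -- Sign, power sum and 1/λⁿ are all n-th powers; together they form aⁿ, with 1/n! left over.
  signed-factor : ∀ β → (- 1ℚ) ^ℚ excess β * factor β ≡ blockValue β
  signed-factor (zero  ^^ n) = contradiction refl (ℕ.≢-nonZero⁻¹ 0)
  signed-factor (suc m ^^ n) = begin
    (- 1ℚ) ^ℚ (n ℕ.* m) * (coefficient (suc m ^^ n) * P ^ℚ n)
      ≡⟨ cong₂ (λ s t → s * (t * P ^ℚ n)) (^ℚ-* (- 1ℚ) m n)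
           (trans (recip-* (suc m ℕ.^ n) (n !) ⦃ ℕ.m^n≢0 (suc m) n ⦄ ⦃ n ℕ.!≢0 ⦄)
                  (cong (_* r) (recip-^ (suc m) n))) ⟩
    σ ^ℚ n * (ρ ^ℚ n * r * P ^ℚ n)
      ≡⟨ solve 4 (λ s t r p → s :* (t :* r :* p) := s :* p :* t :* r) refl
           (σ ^ℚ n) (ρ ^ℚ n) r (P ^ℚ n) ⟩
    σ ^ℚ n * P ^ℚ n * ρ ^ℚ n * r
      ≡⟨ cong (λ s → s * ρ ^ℚ n * r) (*-^ℚ σ P n) ⟨
    (σ * P) ^ℚ n * ρ ^ℚ n * r
      ≡⟨ cong (_* r) (*-^ℚ (σ * P) ρ n) ⟨
    (σ * P * ρ) ^ℚ n * r ∎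
    where
    open ≡-Reasoning
    P = powerSum (suc m) ls
    σ = (- 1ℚ) ^ℚ m
    ρ = recip (suc m)
    r = recip (n !) ⦃ n ℕ.!≢0 ⦄

  signed-product : ∀ p → (- 1ℚ) ^ℚ sum (map excess p) * productℚ (map factor p) ≡ value p
  signed-product []      = refl
  signed-product (β ∷ p) = begin
    (- 1ℚ) ^ℚ (excess β ℕ.+ sum (map excess p)) * (factor β * productℚ (map factor p))
      ≡⟨ cong (_* (factor β * productℚ (map factor p)))
           (^ℚ-+ (- 1ℚ) (excess β) (sum (map excess p))) ⟩
    s * t * (factor β * productℚ (map factor p))
      ≡⟨ solve 4 (λ s t x y → s :* t :* (x :* y) := s :* x :* (t :* y)) refl
           s t (factor β) (productℚ (map factor p)) ⟩
    s * factor β * (t * productℚ (map factor p))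
      ≡⟨ cong₂ _*_ (signed-factor β) (signed-product p) ⟩
    value (β ∷ p) ∎
    where
    open ≡-Reasoning
    s = (- 1ℚ) ^ℚ excess β
    t = (- 1ℚ) ^ℚ sum (map excess p)

  elementary≡powerSums : ∀ q → fromℕ (elementary q ls) ≡
    sumℚ (map (λ p → (- 1ℚ) ^ℚ (q ∸ sum (map mult p)) * productℚ (map factor p)) (partitions q))
  elementary≡powerSums q = trans (elementary≡partitionSum q)
    (cong sumℚ (map-cong-local (All.tabulate λ {p} p∈ → sym (trans
      (cong (λ e → (- 1ℚ) ^ℚ e * productℚ (map factor p))
        (trans (cong (_∸ sum (map mult p)) (sym (proj₂ (Equivalence.to (∈-partitions q) p∈))))
               (weights∸mults p)))
      (signed-product p)))))

-- Lines and attacks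

attacks⇒≡lineIndex : ∀ m z w → Attacks m z w → lineIndex m z ≡ lineIndex m w
attacks⇒≡lineIndex (c , d) (x , y) _ (k , _ , refl) = eq c d x y k
  where
  eq : ∀ c d x y k → d ℤ.* x ℤ.- c ℤ.* y ≡ d ℤ.* (x ℤ.+ k ℤ.* c) ℤ.- c ℤ.* (y ℤ.+ k ℤ.* d)
  eq = ℤ-Solver.solve-∀

-- Equal indices mean c (y′ - y) = (x′ - x) d. Coprimality makes d divide y′ - y, the quotient is
-- the number k of steps, and cancelling d gives x′ - x = k c.
≡lineIndex⇒attacks : ∀ {c d} → Coprime c d → d ≢ 0ℤ → ∀ {z w} → z ≢ w →
                     lineIndex (c , d) z ≡ lineIndex (c , d) w → Attacks (c , d) z w
≡lineIndex⇒attacks {c} {d} coprime d≢0 {x , y} {x′ , y′} z≢w e =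
  multiple (∣ᵤ⇒∣ (coprime-divisor d c (y′ ℤ.- y) (λ (p , q) → coprime (q , p))
                    (∣⇒∣ᵤ (divides (x′ ℤ.- x) cross))))
  where
  open ≡-Reasoning

  rearrange : ∀ c d x y x′ y′ → c ℤ.* (y′ ℤ.- y) ≡
              (d ℤ.* x ℤ.- c ℤ.* y) ℤ.- (d ℤ.* x′ ℤ.- c ℤ.* y′) ℤ.+ (x′ ℤ.- x) ℤ.* d
  rearrange = ℤ-Solver.solve-∀

  cross : c ℤ.* (y′ ℤ.- y) ≡ (x′ ℤ.- x) ℤ.* d
  cross = trans (rearrange c d x y x′ y′)
    (trans (cong (ℤ._+ (x′ ℤ.- x) ℤ.* d) (ℤ.i≡j⇒i-j≡0 e)) (ℤ.+-identityˡ _))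

  recover : ∀ i j → i ≡ j ℤ.+ (i ℤ.- j)
  recover = ℤ-Solver.solve-∀

  commute : ∀ c k d → c ℤ.* (k ℤ.* d) ≡ (k ℤ.* c) ℤ.* d
  commute = ℤ-Solver.solve-∀

  multiple : d ∣ (y′ ℤ.- y) → Attacks (c , d) (x , y) (x′ , y′)
  multiple (divides k ey) = k , k≢0 , cong₂ _,_ x′≡ y′≡
    where
    ex : x′ ℤ.- x ≡ k ℤ.* c
    ex = ℤ.*-cancelʳ-≡ _ _ d ⦃ ℤ.≢-nonZero d≢0 ⦄
      (trans (sym cross) (trans (cong (c ℤ.*_) ey) (commute c k d)))
    x′≡ : x′ ≡ x ℤ.+ k ℤ.* c
    x′≡ = trans (recover x′ x) (cong (λ i → x ℤ.+ i) ex)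
    y′≡ : y′ ≡ y ℤ.+ k ℤ.* d
    y′≡ = trans (recover y′ y) (cong (λ i → y ℤ.+ i) ey)
    stay : ∀ {i j s} → k ≡ 0ℤ → i ≡ j ℤ.+ k ℤ.* s → j ≡ i
    stay {j = j} refl eq = sym (trans eq (ℤ.+-identityʳ j))
    k≢0 : k ≢ 0ℤ
    k≢0 k≡0 = z≢w (cong₂ _,_ (stay k≡0 x′≡) (stay k≡0 y′≡))

AllPairs-resp-⊆ : ∀ {A : Set} {R : A → A → Set} {xs ys} →
                  xs ⊆ ys → AllPairs R ys → AllPairs R xs
AllPairs-resp-⊆ []         []       = []
AllPairs-resp-⊆ (_    ∷ʳ s) (_ ∷ rs) = AllPairs-resp-⊆ s rs
AllPairs-resp-⊆ (refl ∷  s) (r ∷ rs) = All-resp-⊆ s r ∷ AllPairs-resp-⊆ s rs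

u≡elementary : ∀ {c d} → Coprime c d → d ≢ 0ℤ → ∀ B q →
               u (c , d) q B ≡ elementary q (lineSizes (c , d) B)
u≡elementary {c} {d} coprime d≢0 B q = trans
  (cong length (filter-cong-∈ (nonAttacking? (c , d)) rainbow? (All.tabulate equivalent)))
  (rainbows≡elementary q points)
  where
  open ConvexBoard B
  open Colouring ℤ._≟_ (lineIndex (c , d))

  equivalent : ∀ {ys} → ys ∈ combinations q points →
    (NonAttacking (c , d) ys → Rainbow ys) × (Rainbow ys → NonAttacking (c , d) ys)
  equivalent ys∈ =
    -- Two pieces on one line attack each other only if they are distinct, which a sublist inherits
    -- from `unique`.
    (λ na → AllPairs.zipWith
      (λ ((z↛w , _) , z≢w) e → z↛w (≡lineIndex⇒attacks coprime d≢0 z≢w e))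
      (na , AllPairs-resp-⊆ (proj₁ (Equivalence.to (∈-combinations q points) ys∈)) unique)) ,
    AllPairs.map λ ne → ne ∘ attacks⇒≡lineIndex (c , d) _ _ ,
                        ne ∘ sym ∘ attacks⇒≡lineIndex (c , d) _ _

-- With d = 0 the inequalities force c = 0, and then 2 is a common divisor.
coprime⇒≢0 : ∀ c d → Coprime c d → 0ℤ ℤ.≤ c → c ℤ.≤ d → d ≢ 0ℤ
coprime⇒≢0 c d coprime 0≤c c≤0 refl with ℤ.≤-antisym c≤0 0≤c
... | refl with coprime {2} ((_∣0 2) , (_∣0 2))
...   | ()

proposition3p1 :
    ∀ (c d : ℤ) → Coprime c d → 0ℤ ≤ c → c ≤ d →
    (B : ConvexBoard) (q : ℕ) → 1 ℕ.≤ q →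
    + (u (c , d) q B) / 1 ≡
      sumℚ (map
        (λ p → (- 1ℚ) ^ℚ (q ∸ sum (map mult p)) *
               productℚ (map
                 (λ b → coefficient b *
                        powerSum (part b) (lineSizes (c , d) B) ^ℚ mult b)
                 p))
        (partitions q))
proposition3p1 c d coprime 0≤c c≤d B q _ = trans
  (cong fromℕ (u≡elementary coprime (coprime⇒≢0 c d coprime 0≤c c≤d) B q))
  (elementary≡powerSums (lineSizes (c , d) B) q)
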